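{- For a directed tree $\mathcal{T}$ and a number $n$ of subcovers, the algorithm $\mathrm{SweepCovers}(\mathcal{T},n)$ returns all sweep-covers with $n$ subcovers from $\mathcal{T}$. If none are possible, then the algorithm returns an empty set.
   Context: All trees are rooted and directed away from the root. A sweep-cover of a tree with vertex set $\mathcal V$ is a collection $S$ of non-empty subsets of $\mathcal V$ (called subcovers) such that: (1) distinct members of $S$ are disjoint; (2) each member of $S$ contains only sibling nodes, i.e. nodes sharing a parent (the singleton of the root is allowed); (3) with $\mathcal C=\bigcup_{S_i\in S}S_i$, every node of $\mathcal V$ is in $\mathcal C$, or is an ancestor of a node of $\mathcal C$, or is a descendant of a node of $\mathcal C$; (4) no node of $\mathcal C$ is an ancestor or descendant of another node of $\mathcal C$. A linear path is a path of edges in which each edge's source node has at most one outgoing edge in the tree. For a node $v$, the lowest linear descendant $\mathcal L(v)$ is the descendant of $v$ (or $v$ itself) such that there is a linear path from $v$ to $\mathcal L(v)$ and $\mathcal L(v)$ has out-degree not equal to $1$. The induced subtree defined by a node $u$ is the subtree containing $u$ and all of the descendants and ancestors of $u$. $\Gamma_{x,m}$ is the collection of all compositions of the integer $x$ into $m$ ordered positive parts. The algorithm $\mathrm{SweepCovers}(\mathcal T,n)$ is recursive and returns a collection $\mathcal Q$, initially empty. Let $v_s$ be the root of $\mathcal T$ and let $C$ be the set of children of the last node $\mathcal L(v_s)$ of the linear path beginning at $v_s$. If $n=1$: $\mathcal Q$ consists of the collections $\{\{w\}\}$ for the nodes $w$ on the linear path from $v_s$ to $\mathcal L(v_s)$,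 together with the collection $\{C\}$. Otherwise: for each partition $H$ of $C$ into $1,2,\dots,$ or $\min\{n,|C|\}$ parts, let $L$ be the collection of all singletons in $H$ and $R$ the collection of all non-singletons in $H$. If $|L|=0$ and $|R|=n$, add $R$ to $\mathcal Q$. Otherwise, for each composition $X=(X_1,\dots,X_{|L|})\in\Gamma_{n-|R|,|L|}$, form all combinations of one element of $\mathrm{SweepCovers}(\mathcal T_{L_k},X_k)$ for each $k=1,\dots,|L|$, together with $R$, where $\mathcal T_{L_k}$ is the induced subtree defined by $L_k\in L$; add to $\mathcal Q$ every resulting collection $S$ of subcovers with $|S|=n$. Finally return $\mathcal Q$.
   Formalization: As worded the algorithm also returns non-sweep-covers; exact equality is proved when it recurses on the subtree rooted at L_k without ancestors and adds {C} only if C is non-empty; as worded, it is proved to return every sweep-cover, and nothing if there are none. -}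

module Defs where

open import Data.Bool.Base using (if_then_else_)
import Data.Bool.Properties as Bool
open import Data.Fin.Base using (Fin)
open import Data.Fin.Subset using (Subset; ⁅_⁆; ⋃; Nonempty; Empty; _∩_)
  renaming (_∈_ to _∈ˢ_)
open import Data.List.Base
  using (List; []; _∷_; [_]; _++_; _∷ʳ_; map; concat; concatMap; filter;
         foldr; length; upTo; zipWith; deduplicate; cartesianProductWith)
open import Data.List.Membership.Propositional using (_∈_)
open import Data.List.Properties using (++-identityʳ; ++-assoc)
open import Data.List.Relation.Binary.BagAndSetEquality using (_∼[_]_; set)
open import Data.List.Relation.Unary.Any using (Any)
open import Data.List.Relation.Unary.Unique.Propositional using (Unique)
open import Data.Nat.Base using (ℕ; zero; suc; _∸_; _⊓_)
open import Data.Nat.Properties using (_≟_; _≤?_)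
open import Data.Product.Base using (_×_; _,_; proj₁; proj₂; ∃-syntax)
open import Data.Sum.Base using (_⊎_)
open import Data.Vec.Properties using (≡-dec)
open import Relation.Binary.Construct.Closure.Transitive using (TransClosure)
open import Relation.Binary.PropositionalEquality
  using (_≡_; _≢_; refl; cong; sym; trans)
open import Relation.Nullary using (¬_; does; _×-dec_)

private
  variable
    N : ℕ

-- Nodes are named by elements of Fin N.  Not every name need be used, so
-- that subtrees of a tree are trees over the same names.
data Tree (N : ℕ) : Set where
  node : Fin N → List (Tree N) → Tree N

root : Tree N → Fin N
root (node v _) = v

mutual
  vertices : Tree N → List (Fin N)
  vertices (node v ts) = v ∷ verticesOfForest ts

  verticesOfForest : List (Tree N) → List (Fin N)
  verticesOfForest []       = []
  verticesOfForest (t ∷ ts) = vertices t ++ verticesOfForest ts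

-- A term of type Tree N denotes a tree with vertex set `vertices t` only
-- when no name is used twice.
DistinctVertices : Tree N → Set
DistinctVertices t = Unique (vertices t)

data Edge {N : ℕ} : Tree N → Fin N → Fin N → Set where
  here  : ∀ {v ts t} → t ∈ ts → Edge (node v ts) v (root t)
  there : ∀ {v ts t u w} → t ∈ ts → Edge t u w → Edge (node v ts) u w

-- Ancestor t u w : u is a (proper) ancestor of w in t.
Ancestor : Tree N → Fin N → Fin N → Set
Ancestor t = TransClosure (Edge t)

-- A finite collection of sets of nodes.  Order and repetitions are
-- immaterial: collections are compared by _∼[ set ]_ and counted by `card`.
Collection : ℕ → Set
Collection N = List (Subset N)

card : Collection N → ℕ
card S = length (deduplicate (≡-dec Bool._≟_) S)

infix 4 _∈ᶜ_

_∈ᶜ_ : Collection N → List (Collection N) → Set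
S ∈ᶜ Q = Any (λ S′ → S ∼[ set ] S′) Q

record IsSweepCover (t : Tree N) (S : Collection N) : Set where
  field
    subset    : ∀ {A v} → A ∈ S → v ∈ˢ A → v ∈ vertices t
    nonempty  : ∀ {A} → A ∈ S → Nonempty A
    disjoint  : ∀ {A B} → A ∈ S → B ∈ S → A ≢ B → Empty (A ∩ B)
    siblings  : ∀ {A} → A ∈ S →
                (∃[ p ] ∀ {v} → v ∈ˢ A → Edge t p v) ⊎ A ≡ ⁅ root t ⁆
    covering  : ∀ {v} → v ∈ vertices t →
                v ∈ˢ ⋃ S
                ⊎ (∃[ w ] w ∈ˢ ⋃ S × Ancestor t v w)
                ⊎ (∃[ w ] w ∈ˢ ⋃ S × Ancestor t w v)
    antichain : ∀ {v w} → v ∈ˢ ⋃ S → w ∈ˢ ⋃ S → ¬ Ancestor t v w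

SweepCoverOfSize : Tree N → ℕ → Collection N → Set
SweepCoverOfSize t n S = IsSweepCover t S × card S ≡ n

private
  variable
    A : Set

-- All ways of adding x to one of the blocks of H.
insertIntoBlock : A → List (List A) → List (List (List A))
insertIntoBlock x []      = []
insertIntoBlock x (B ∷ H) =
  ((x ∷ B) ∷ H) ∷ map (B ∷_) (insertIntoBlock x H)

partitions : List A → List (List (List A))
partitions []       = [ [] ]
partitions (x ∷ xs) =
  concatMap (λ H → ([ x ] ∷ H) ∷ insertIntoBlock x H) (partitions xs)

-- The elements c with [ c ] a block, rather than the blocks [ c ].
singletons : List (List A) → List A
singletons []                = []
singletons ([] ∷ H)          = singletons H
singletons ((c ∷ []) ∷ H)    = c ∷ singletons H
singletons ((_ ∷ _ ∷ _) ∷ H) = singletons H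

nonSingletons : List (List A) → List (List A)
nonSingletons []                 = []
nonSingletons ([] ∷ H)           = [] ∷ nonSingletons H
nonSingletons ((_ ∷ []) ∷ H)     = nonSingletons H
nonSingletons ((c ∷ d ∷ cs) ∷ H) = (c ∷ d ∷ cs) ∷ nonSingletons H

-- Compositions of x into m ordered positive parts.
Γ : ℕ → ℕ → List (List ℕ)
Γ zero    zero    = [ [] ]
Γ (suc x) zero    = []
Γ x       (suc m) =
  concatMap (λ i → map (suc i ∷_) (Γ (x ∸ suc i) m)) (upTo x)

-- All ways of choosing one element from each list.
choices : List (List A) → List (List A)
choices = foldr (cartesianProductWith _∷_) [ [] ]

-- Taken word for word, the algorithm also returns collections that are
-- not sweep-covers, for two reasons.
--   * The induced subtree of u keeps the ancestors of u, so its root is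
--     still v_s and a recursive call with n = 1 returns {{v_s}}.
--     From a root r with children a, b one gets {{r},{b}} for n = 2.
--   * If v_s starts a linear path ending in a leaf, then C = ∅ and {∅} is
--     returned for n = 1, although subcovers are non-empty.
-- `literal` follows the wording; `intended` takes the recursive call on
-- the subtree rooted at u, and returns {C} only if C is non-empty.
data Reading : Set where
  literal intended : Reading

-- A child of the last node of the linear path, together with the recursive
-- call of the algorithm on the subtree it induces.
Child : ℕ → Set
Child N = Fin N × (ℕ → List (Collection N))

nodeSet : List (Child N) → Subset N
nodeSet C = ⋃ (map (λ c → ⁅ proj₁ c ⁆) C)

allChildren : Reading → List (Child N) → List (Collection N)
allChildren literal  C       = [ [ nodeSet C ] ]
allChildren intended []      = []
allChildren intended (c ∷ C) = [ [ nodeSet (c ∷ C) ] ]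

admissiblePartitions : ℕ → List A → List (List (List A))
admissiblePartitions n C =
  filter (λ H → (1 ≤? length H) ×-dec (length H ≤? n ⊓ length C))
         (partitions C)

fromPartition : ℕ → List (List (Child N)) → List (Collection N)
fromPartition n H =
  if does ((length L ≟ 0) ×-dec (length R ≟ n))
  then [ R ]
  else concatMap
         (λ X → filter (λ S → card S ≟ n)
                  (map (λ Ss → concat Ss ++ R)
                       (choices (zipWith proj₂ L X))))
         (Γ (n ∸ length R) (length L))
  where
  L = singletons H
  R = map nodeSet (nonSingletons H)

-- path: the nodes of the linear path; C: the children of its last node.
step : Reading → List (Fin N) → List (Child N) → ℕ → List (Collection N)
step ρ path C 1 = map (λ w → [ ⁅ w ⁆ ]) path ++ allChildren ρ C
step ρ path C n = concatMap (fromPartition n) (admissiblePartitions n C)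

-- The part of the path from v_s to the parent of L_k that belongs to the
-- induced subtree of L_k.
above : Reading → List (Fin N) → List (Fin N)
above literal  path = path
above intended path = []

-- run ρ path t is the algorithm on the tree obtained by hanging t below
-- the linear path `path` (see run-chain); it walks down to the end of the
-- linear path, collecting its nodes.
mutual
  run : Reading → List (Fin N) → Tree N → ℕ → List (Collection N)
  run ρ path (node v [])             n = step ρ (path ∷ʳ v) [] n
  run ρ path (node v (t ∷ []))       n = run ρ (path ∷ʳ v) t n
  run ρ path (node v (t ∷ t′ ∷ ts))  n =
    step ρ (path ∷ʳ v) (runs ρ (above ρ (path ∷ʳ v)) (t ∷ t′ ∷ ts)) n

  runs : Reading → List (Fin N) → List (Tree N) → List (Child N)
  runs ρ path []       = []
  runs ρ path (t ∷ ts) = (root t , run ρ path t) ∷ runs ρ path ts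

SweepCovers : Reading → Tree N → ℕ → List (Collection N)
SweepCovers ρ t n = run ρ [] t n

-- chain path t is t with a linear path added above its root.  For L_k a
-- child of the end of the linear path `path`, the induced subtree of L_k,
-- ancestors included, is chain path (subtree rooted at L_k).
chain : List (Fin N) → Tree N → Tree N
chain []         t = t
chain (v ∷ path) t = node v [ chain path t ]

run-chain : ∀ ρ path (t : Tree N) n →
            SweepCovers ρ (chain path t) n ≡ run ρ path t n
run-chain ρ = go []
  where
  go : ∀ done path (t : Tree N) n →
       run ρ done (chain path t) n ≡ run ρ (done ++ path) t n
  go done []         t n =
    cong (λ p → run ρ p t n) (sym (++-identityʳ done))
  go done (v ∷ path) t n =
    trans (go (done ∷ʳ v) path t n)
          (cong (λ p → run ρ p t n) (++-assoc done [ v ] path))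

{-# OPTIONS --safe #-}
module Submission where

-- A sweep-cover that avoids the root v restricts to the children of v: each
-- child is either a member of a subcover with other children, or carries a
-- sweep-cover of its own subtree. Grouping the children by the subcover
-- containing them, and leaving the remaining ones alone, gives the partition H
-- of the algorithm, its singletons being the children that carry their own
-- sweep-cover. Conversely, sweep-covers of the subtrees at the singletons of a
-- partition together with its other blocks form a sweep-cover, whose number of
-- subcovers is the sum of the numbers for its parts. A linear path is the case
-- of one child, the collection {C} the case of one block.

open import Defs
import Data.Bool.Properties as Bool
open import Data.Bool.Base using (if_then_else_)
open import Data.Fin.Base using (Fin)
open import Data.Fin.Subset using (Subset; ⁅_⁆; ⋃; Nonempty)
  renaming (_∈_ to _∈ˢ_)
open import Data.Fin.Subset.Properties
  using (∉⊥; x∈⁅x⁆; x∈⁅y⁆⇒x≡y; ⊆-antisym; x∈p∪q⁺; x∈p∪q⁻; x∈p∩q⁺; x∈p∩q⁻; _∈?_)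
open import Data.List.Base
  using (List; []; _∷_; [_]; _++_; _∷ʳ_; map; concat; concatMap; filter;
         length; upTo; zipWith; deduplicate)
open import Data.List.Membership.Propositional using (_∈_; find; lose)
open import Data.List.Membership.Propositional.Properties
  using (∈-map⁺; ∈-map⁻; ∈-++⁺ˡ; ∈-++⁺ʳ; ∈-++⁻; ∈-concat⁺′; ∈-concat⁻′;
         ∈-concatMap⁺; ∈-concatMap⁻; ∈-cartesianProductWith⁺;
         ∈-cartesianProductWith⁻; ∈-upTo⁺; ∈-upTo⁻; ∈-filter⁺; ∈-filter⁻;
         deduplicate-∈⇔; ∈-length)
open import Data.List.Membership.Propositional.Properties.WithK
  using (unique∧set⇒bag)
open import Data.List.Properties
  using (map-∘; map-id; map-cong; concatMap-cong; concatMap-map; map-concatMap;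
         length-map; length-++; ++-identityʳ)
open import Data.List.Relation.Binary.BagAndSetEquality
  using (_∼[_]_; set; ∼bag⇒↭)
open import Data.List.Relation.Binary.Permutation.Propositional
  using (_↭_; ↭-refl; ↭-sym; ↭-trans; ↭-prep; ↭⇒↭ₛ; ↭-reflexive)
open import Data.List.Relation.Binary.Permutation.Propositional.Properties
  using (∈-resp-↭; ↭-length; shift; shifts; ++⁺ˡ)
import Data.List.Relation.Binary.Permutation.Setoid.Properties as Permₛ
open import Data.List.Relation.Unary.All as All using (All; []; _∷_)
import Data.List.Relation.Unary.All.Properties as All
open import Data.List.Relation.Unary.AllPairs as AllPairs using (AllPairs; []; _∷_)
import Data.List.Relation.Unary.AllPairs.Properties as AllPairs
open import Data.List.Relation.Unary.Any as Any using (Any; here; there; any?)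
open import Data.List.Relation.Unary.Unique.Propositional using (Unique)
import Data.List.Relation.Unary.Unique.Propositional.Properties as Unique
import Data.List.Relation.Unary.Unique.DecPropositional.Properties as DecUnique
open import Data.Nat.Base using (ℕ; zero; suc; _+_; _∸_; _⊓_; _≤_; z≤n; s≤s)
open import Data.Nat.ListAction using (sum)
open import Data.Nat.Properties
  using (_≟_; _≤?_; ≤-trans; ≤-refl; ≤-reflexive; m+[n∸m]≡n; m∸n+n≡m; m+n∸m≡n;
         m+n∸n≡m; m≤m+n; m≤n+m; +-mono-≤; ⊓-glb; m⊓n≤m;
         suc-injective; +-suc)
open import Data.Product.Base
  using (_×_; _,_; proj₁; proj₂; ∃-syntax; Σ-syntax)
open import Data.Sum.Base using (_⊎_; inj₁; inj₂; [_,_]′)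
open import Data.Vec.Properties using (≡-dec)
open import Function.Base using (_∘_; id)
open import Function.Bundles using (_⇔_; mk⇔; Equivalence)
import Relation.Binary.Construct.Closure.Transitive as Plus
open import Relation.Binary.Definitions using (DecidableEquality)
open import Relation.Binary.PropositionalEquality
  using (_≡_; _≢_; refl; cong; cong₂; sym; trans; subst; setoid)
open import Relation.Nullary using (¬_; Dec; yes; no; does; contradiction; _×-dec_)

-- The literal reading is not sound, yet its emptiness claim holds. Both readings therefore share
-- one induction whose invariant is weaker than soundness: every output can be replaced by a genuine
-- sweep-cover with the same number of subcovers, and in the intended reading the replacement is the
-- output itself. For emptiness only the existence of a cover of the right size matters; for
-- completeness the surplus outputs of the literal reading do no harm. The other obstacle is
-- counting. Collections are lists up to set equality, while compositions prescribe exact numbers,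
-- so the size of an assembled collection has to be shown additive. This rests on distinct children
-- having disjoint vertex sets and on subcovers being non-empty: a non-empty set of nodes cannot
-- occur in the covers of two children.

private
  variable
    A B : Set
    N : ℕ

-- Lists without repetitions

sum-map≥length : (f : A → ℕ) {xs : List A} → All (λ x → 1 ≤ f x) xs →
                 length xs ≤ sum (map f xs)
sum-map≥length f []         = z≤n
sum-map≥length f (px ∷ pxs) = +-mono-≤ px (sum-map≥length f pxs)

Unique-resp-↭ : {xs ys : List A} → xs ↭ ys → Unique xs → Unique ys
Unique-resp-↭ σ = Permₛ.Unique-resp-↭ (setoid _) (↭⇒↭ₛ σ)

Unique-++⁻ : (xs : List A) {ys : List A} → Unique (xs ++ ys) →
             Unique xs × Unique ys × (∀ {x} → x ∈ xs → ¬ x ∈ ys)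
Unique-++⁻ []       u        = [] , u , λ ()
Unique-++⁻ (x ∷ xs) (px ∷ u) with Unique-++⁻ xs u
... | uxs , uys , dis =
  All.++⁻ˡ xs px ∷ uxs , uys ,
  λ { (here refl) y∈ → All.lookup (All.++⁻ʳ xs px) y∈ refl
    ; (there x∈)  y∈ → dis x∈ y∈ }

Unique-map-injective : (f : A → B) {xs : List A} → Unique (map f xs) →
                       ∀ {x y} → x ∈ xs → y ∈ xs → f x ≡ f y → x ≡ y
Unique-map-injective f (p ∷ u) (here refl) (here refl) eq = refl
Unique-map-injective f (p ∷ u) (here refl) (there y∈)  eq =
  contradiction eq (All.lookup p (∈-map⁺ f y∈))
Unique-map-injective f (p ∷ u) (there x∈)  (here refl) eq =
  contradiction (sym eq) (All.lookup p (∈-map⁺ f x∈))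
Unique-map-injective f (p ∷ u) (there x∈)  (there y∈)  eq =
  Unique-map-injective f u x∈ y∈ eq

Unique-map : (f : A → B) {xs : List A} →
             (∀ {x y} → x ∈ xs → y ∈ xs → f x ≡ f y → x ≡ y) →
             Unique xs → Unique (map f xs)
Unique-map f inj []      = []
Unique-map f inj (p ∷ u) =
  All.map⁺ (All.tabulate λ y∈ eq →
    All.lookup p y∈ (inj (here refl) (there y∈) eq))
  ∷ Unique-map f (λ x∈ y∈ → inj (there x∈) (there y∈)) u

Unique-concat-block : (H : List (List A)) → Unique (concat H) →
                      ∀ {b c x} → b ∈ H → c ∈ H → x ∈ b → x ∈ c → b ≡ c
Unique-concat-block (d ∷ H) u (here refl) (here refl) x∈b x∈c = refl
Unique-concat-block (d ∷ H) u (here refl) (there c∈)  x∈b x∈c =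
  contradiction (∈-concat⁺′ x∈c c∈) (proj₂ (proj₂ (Unique-++⁻ d u)) x∈b)
Unique-concat-block (d ∷ H) u (there b∈)  (here refl) x∈b x∈c =
  contradiction (∈-concat⁺′ x∈b b∈) (proj₂ (proj₂ (Unique-++⁻ d u)) x∈c)
Unique-concat-block (d ∷ H) u (there b∈)  (there c∈)  x∈b x∈c =
  Unique-concat-block H (proj₁ (proj₂ (Unique-++⁻ d u))) b∈ c∈ x∈b x∈c

-- Equal non-empty blocks would repeat an element of `concat H`; empty blocks could repeat
-- unnoticed.
Unique-blocks : {H : List (List A)} → All (_≢ []) H → Unique (concat H) → Unique H
Unique-blocks []                   u = []
Unique-blocks {H = [] ∷ H}      (≢[] ∷ ne) u = contradiction refl ≢[]
Unique-blocks {H = (x ∷ d) ∷ H} (≢[] ∷ ne) u =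
  All.tabulate (λ b∈ eq → proj₂ (proj₂ (Unique-++⁻ (x ∷ d) u)) (here refl)
    (∈-concat⁺′ (here refl) (subst (_∈ H) (sym eq) b∈)))
  ∷ Unique-blocks ne (proj₁ (proj₂ (Unique-++⁻ (x ∷ d) u)))

-- Partitions of a list, their singletons and their other blocks

insertIntoBlock-↭ : (x : A) (H : List (List A)) → ∀ {H′} → H′ ∈ insertIntoBlock x H →
                    concat H′ ↭ x ∷ concat H
insertIntoBlock-↭ x (b ∷ H) (here refl) = ↭-refl
insertIntoBlock-↭ x (b ∷ H) (there H′∈) with ∈-map⁻ (b ∷_) H′∈
... | H″ , H″∈ , refl =
  ↭-trans (++⁺ˡ b (insertIntoBlock-↭ x H H″∈)) (shift x b (concat H))

insertIntoBlock-nonempty : (x : A) {H : List (List A)} → All (_≢ []) H →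
                           ∀ {H′} → H′ ∈ insertIntoBlock x H → All (_≢ []) H′
insertIntoBlock-nonempty x (b≢[] ∷ ne) (here refl) = (λ ()) ∷ ne
insertIntoBlock-nonempty x {b ∷ H} (b≢[] ∷ ne) (there H′∈) with ∈-map⁻ (b ∷_) H′∈
... | H″ , H″∈ , refl = b≢[] ∷ insertIntoBlock-nonempty x ne H″∈

partitions-sound : (xs : List A) → ∀ {H} → H ∈ partitions xs →
                   concat H ↭ xs × All (_≢ []) H
partitions-sound []       (here refl) = ↭-refl , []
partitions-sound (x ∷ xs) H∈
  with find (∈-concatMap⁻ (λ H → ([ x ] ∷ H) ∷ insertIntoBlock x H)
                          {xs = partitions xs} H∈)
... | H₀ , H₀∈ , here refl =
  ↭-prep x (proj₁ (partitions-sound xs H₀∈)) ,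
  (λ ()) ∷ proj₂ (partitions-sound xs H₀∈)
... | H₀ , H₀∈ , there H∈ins =
  ↭-trans (insertIntoBlock-↭ x H₀ H∈ins) (↭-prep x (proj₁ (partitions-sound xs H₀∈))) ,
  insertIntoBlock-nonempty x (proj₂ (partitions-sound xs H₀∈)) H∈ins

insertIntoBlock-map : (f : A → B) (x : A) (H : List (List A)) →
                      insertIntoBlock (f x) (map (map f) H)
                      ≡ map (map (map f)) (insertIntoBlock x H)
insertIntoBlock-map f x []      = refl
insertIntoBlock-map f x (b ∷ H) = cong₂ _∷_ refl
  (trans (cong (map (map f b ∷_)) (insertIntoBlock-map f x H))
         (trans (sym (map-∘ (insertIntoBlock x H))) (map-∘ (insertIntoBlock x H))))

-- The algorithm partitions a list of pairs of a node and a recursive call. Naturality allows the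
-- argument to be carried out on partitions of the list of subtrees instead.
partitions-map : (f : A → B) (xs : List A) →
                 partitions (map f xs) ≡ map (map (map f)) (partitions xs)
partitions-map f []       = refl
partitions-map f (x ∷ xs) =
  trans (cong (concatMap ext) (partitions-map f xs))
  (trans (concatMap-map ext (map (map f)) (partitions xs))
  (trans (concatMap-cong (λ H → cong₂ _∷_ refl (insertIntoBlock-map f x H)) (partitions xs))
         (sym (map-concatMap (map (map f)) _ (partitions xs)))))
  where
  ext = λ H → ([ f x ] ∷ H) ∷ insertIntoBlock (f x) H

singletons-map : (f : A → B) (H : List (List A)) →
                 singletons (map (map f) H) ≡ map f (singletons H)
singletons-map f []                = refl
singletons-map f ([] ∷ H)          = singletons-map f H
singletons-map f ((c ∷ []) ∷ H)    = cong (f c ∷_) (singletons-map f H)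
singletons-map f ((_ ∷ _ ∷ _) ∷ H) = singletons-map f H

nonSingletons-map : (f : A → B) (H : List (List A)) →
                    nonSingletons (map (map f) H) ≡ map (map f) (nonSingletons H)
nonSingletons-map f []                = refl
nonSingletons-map f ([] ∷ H)          = cong (_ ∷_) (nonSingletons-map f H)
nonSingletons-map f ((c ∷ []) ∷ H)    = nonSingletons-map f H
nonSingletons-map f ((_ ∷ _ ∷ _) ∷ H) = cong (_ ∷_) (nonSingletons-map f H)

singletons-↭ : (H : List (List A)) →
               concat H ↭ singletons H ++ concat (nonSingletons H)
singletons-↭ []                 = ↭-refl
singletons-↭ ([] ∷ H)           = singletons-↭ H
singletons-↭ ((c ∷ []) ∷ H)     = ↭-prep c (singletons-↭ H)
singletons-↭ ((c ∷ d ∷ cs) ∷ H) =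
  ↭-trans (++⁺ˡ (c ∷ d ∷ cs) (singletons-↭ H))
          (shifts (c ∷ d ∷ cs) (singletons H))

length-singletons : (H : List (List A)) →
                    length H ≡ length (singletons H) + length (nonSingletons H)
length-singletons []                = refl
length-singletons ([] ∷ H)          =
  trans (cong suc (length-singletons H))
        (sym (+-suc (length (singletons H)) _))
length-singletons ((c ∷ []) ∷ H)    = cong suc (length-singletons H)
length-singletons ((_ ∷ _ ∷ _) ∷ H) =
  trans (cong suc (length-singletons H))
        (sym (+-suc (length (singletons H)) _))

∈-singletons⁻ : (H : List (List A)) → ∀ {c} → c ∈ singletons H → [ c ] ∈ H
∈-singletons⁻ ([] ∷ H)          c∈          = there (∈-singletons⁻ H c∈)
∈-singletons⁻ ((_ ∷ []) ∷ H)    (here refl) = here refl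
∈-singletons⁻ ((_ ∷ []) ∷ H)    (there c∈)  = there (∈-singletons⁻ H c∈)
∈-singletons⁻ ((_ ∷ _ ∷ _) ∷ H) c∈          = there (∈-singletons⁻ H c∈)

∈-nonSingletons⁻ : (H : List (List A)) → ∀ {b} → b ∈ nonSingletons H → b ∈ H
∈-nonSingletons⁻ ([] ∷ H)          (here refl) = here refl
∈-nonSingletons⁻ ([] ∷ H)          (there b∈)  = there (∈-nonSingletons⁻ H b∈)
∈-nonSingletons⁻ ((_ ∷ []) ∷ H)    b∈          = there (∈-nonSingletons⁻ H b∈)
∈-nonSingletons⁻ ((_ ∷ _ ∷ _) ∷ H) (here refl) = here refl
∈-nonSingletons⁻ ((_ ∷ _ ∷ _) ∷ H) (there b∈)  = there (∈-nonSingletons⁻ H b∈)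

singleton∉nonSingletons : (H : List (List A)) → ∀ {c} → ¬ [ c ] ∈ nonSingletons H
singleton∉nonSingletons ([] ∷ H)          (there b∈) = singleton∉nonSingletons H b∈
singleton∉nonSingletons ((_ ∷ []) ∷ H)    b∈         = singleton∉nonSingletons H b∈
singleton∉nonSingletons ((_ ∷ _ ∷ _) ∷ H) (there b∈) = singleton∉nonSingletons H b∈

length≤length-concat : {H : List (List A)} → All (_≢ []) H →
                       length H ≤ length (concat H)
length≤length-concat {H = []}          _          = z≤n
length≤length-concat {H = [] ∷ _}      (≢[] ∷ _)  = contradiction refl ≢[]
length≤length-concat {H = (x ∷ b) ∷ H} (_ ∷ ne)   =
  s≤s (≤-trans (length≤length-concat ne)
      (≤-trans (m≤n+m _ (length b)) (≤-reflexive (sym (length-++ b)))))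

-- Partitions into classes of equal key

module _ (_≟ᵇ_ : DecidableEquality B) (key : A → B) where

  Uniform : List A → Set
  Uniform b = ∀ {x y} → x ∈ b → y ∈ b → key x ≡ key y

  Apart : List A → List A → Set
  Apart b c = ∀ {x y} → x ∈ b → y ∈ c → key x ≢ key y

  insert-class : ∀ x {H} → All Uniform H → AllPairs Apart H →
                 Any (Any (λ y → key x ≡ key y)) H →
                 ∃[ H′ ] H′ ∈ insertIntoBlock x H × All Uniform H′ × AllPairs Apart H′
  insert-class x {b ∷ H} (ub ∷ uH) (ab ∷ aH) (here x≈) with find x≈
  ... | y , y∈ , kx≡ky =
    (x ∷ b) ∷ H , here refl ,
    (λ { (here refl) (here refl) → refl
       ; (here refl) (there q)   → trans kx≡ky (ub y∈ q)
       ; (there p)   (here refl) → trans (ub p y∈) (sym kx≡ky)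
       ; (there p)   (there q)   → ub p q }) ∷ uH ,
    All.map (λ bc → λ { (here refl) q eq → bc y∈ q (trans (sym kx≡ky) eq)
                      ; (there p)   q    → bc p q }) ab ∷ aH
  insert-class x {b ∷ H} (ub ∷ uH) (ab ∷ aH) (there x≈)
    with insert-class x uH aH x≈
  ... | H′ , H′∈ , uH′ , aH′ =
    b ∷ H′ , there (∈-map⁺ (b ∷_) H′∈) , ub ∷ uH′ ,
    All.tabulate (λ c∈ p q →
      away p (∈-resp-↭ (insertIntoBlock-↭ x H H′∈) (∈-concat⁺′ q c∈))) ∷ aH′
    where
    -- The new element shares its key with some element of a later block, from which `b` is already
    -- apart.
    away : ∀ {y z} → y ∈ b → z ∈ x ∷ concat H → key y ≢ key z
    away p (here refl) eq with find x≈
    ... | c , c∈ , x≈c with find x≈c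
    ... | w , w∈ , kx≡kw = All.lookup ab c∈ p w∈ (trans eq kx≡kw)
    away p (there q) with ∈-concat⁻′ H q
    ... | c , q∈ , c∈ = All.lookup ab c∈ p q∈

  -- The form of completeness of `partitions` that is used: it lists the classes of every
  -- equivalence given by equality of keys, for some order of blocks and of elements within them.
  partition-by-key : ∀ xs → ∃[ H ] H ∈ partitions xs × All Uniform H × AllPairs Apart H
  partition-by-key []       = [] , here refl , [] , []
  partition-by-key (x ∷ xs) with partition-by-key xs
  ... | H , H∈ , uH , aH with any? (any? (λ y → key x ≟ᵇ key y)) H
  ... | no new =
    [ x ] ∷ H , ∈-concatMap⁺ _ (lose H∈ (here refl)) ,
    (λ { (here refl) (here refl) → refl }) ∷ uH ,
    All.tabulate (λ c∈ → λ { (here refl) q eq → new (lose c∈ (lose q eq)) }) ∷ aH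
  ... | yes old with insert-class x uH aH old
  ... | H′ , H′∈ , uH′ , aH′ =
    H′ , ∈-concatMap⁺ _ (lose H∈ (there H′∈)) , uH′ , aH′

-- `AllPairs` relates earlier to later entries only. The relative position of `b` and `c` is
-- unknown, so both directions have to be refuted.
AllPairs-same : {R : List A → List A → Set} {H : List (List A)} → AllPairs R H →
                   ∀ {b c} → b ∈ H → c ∈ H → ¬ R b c → ¬ R c b → b ≡ c
AllPairs-same (p ∷ ps) (here refl) (here refl) _  _  = refl
AllPairs-same (p ∷ ps) (here refl) (there c∈)  nr _  = contradiction (All.lookup p c∈) nr
AllPairs-same (p ∷ ps) (there b∈)  (here refl) _  nr = contradiction (All.lookup p b∈) nr
AllPairs-same (p ∷ ps) (there b∈)  (there c∈)  nr mr = AllPairs-same ps b∈ c∈ nr mr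

-- Compositions

Γ-sound : ∀ x m {X} → X ∈ Γ x m → sum X ≡ x × length X ≡ m
Γ-sound zero    zero    (here refl) = refl , refl
Γ-sound x       (suc m) X∈
  with find (∈-concatMap⁻ (λ i → map (suc i ∷_) (Γ (x ∸ suc i) m))
                          {xs = upTo x} (unfold x X∈))
  where
  -- The clauses of `Γ` split on its first argument, so `Γ y (suc m)` computes only when `y` is a
  -- constructor.
  unfold : ∀ y {Y} → Y ∈ Γ y (suc m) →
           Y ∈ concatMap (λ i → map (suc i ∷_) (Γ (y ∸ suc i) m)) (upTo y)
  unfold zero    Y∈ = Y∈
  unfold (suc _) Y∈ = Y∈
... | i , i∈ , X∈′ with ∈-map⁻ (suc i ∷_) X∈′
... | Y , Y∈ , refl with Γ-sound (x ∸ suc i) m Y∈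
... | s , l = trans (cong (suc i +_) s) (m+[n∸m]≡n (∈-upTo⁻ i∈)) , cong suc l

Γ-complete : {X : List ℕ} → All (1 ≤_) X → X ∈ Γ (sum X) (length X)
Γ-complete []                             = here refl
Γ-complete {X = suc i ∷ X} (s≤s z≤n ∷ pX) =
  ∈-concatMap⁺ _ (lose (∈-upTo⁺ (s≤s (m≤m+n i (sum X))))
    (∈-map⁺ (suc i ∷_) (subst (λ y → X ∈ Γ y (length X)) (sym (m+n∸m≡n i (sum X)))
      (Γ-complete pX))))

-- Vertices, edges and ancestors

root∈vertices : (t : Tree N) → root t ∈ vertices t
root∈vertices (node v ts) = here refl

∈-forest⁺ : {ts : List (Tree N)} → ∀ {t w} → t ∈ ts → w ∈ vertices t →
            w ∈ verticesOfForest ts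
∈-forest⁺            (here refl) w∈ = ∈-++⁺ˡ w∈
∈-forest⁺ {ts = t ∷ _} (there t∈)  w∈ = ∈-++⁺ʳ (vertices t) (∈-forest⁺ t∈ w∈)

∈-forest⁻ : (ts : List (Tree N)) → ∀ {w} → w ∈ verticesOfForest ts →
            ∃[ t ] t ∈ ts × w ∈ vertices t
∈-forest⁻ (t ∷ ts) w∈ with ∈-++⁻ (vertices t) w∈
... | inj₁ w∈t = t , here refl , w∈t
... | inj₂ w∈ts with ∈-forest⁻ ts w∈ts
... | t′ , t′∈ , w∈t′ = t′ , there t′∈ , w∈t′

Edge-source : {t : Tree N} → ∀ {u w} → Edge t u w → u ∈ vertices t
Edge-source (here _)     = here refl
Edge-source (there t∈ e) = there (∈-forest⁺ t∈ (Edge-source e))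

Edge-target : ∀ {v : Fin N} {ts u w} → Edge (node v ts) u w → w ∈ verticesOfForest ts
Edge-target (here {t = t} t∈)            = ∈-forest⁺ t∈ (root∈vertices t)
Edge-target (there {t = node _ _} t∈ e) = ∈-forest⁺ t∈ (there (Edge-target e))

Edge-target′ : {t : Tree N} → ∀ {u w} → Edge t u w → w ∈ vertices t
Edge-target′ {t = node _ _} e = there (Edge-target e)

Ancestor-source : {t : Tree N} → ∀ {u w} → Ancestor t u w → u ∈ vertices t
Ancestor-source Plus.[ e ]     = Edge-source e
Ancestor-source (e Plus.∷ _) = Edge-source e

Ancestor-target : ∀ {v : Fin N} {ts u w} → Ancestor (node v ts) u w →
                  w ∈ verticesOfForest ts
Ancestor-target Plus.[ e ]     = Edge-target e
Ancestor-target (_ Plus.∷ a) = Ancestor-target a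

Ancestor-target′ : {t : Tree N} → ∀ {u w} → Ancestor t u w → w ∈ vertices t
Ancestor-target′ {t = node _ _} a = there (Ancestor-target a)

Ancestor-lift : ∀ {v : Fin N} {ts t u w} → t ∈ ts → Ancestor t u w →
                Ancestor (node v ts) u w
Ancestor-lift t∈ Plus.[ e ]     = Plus.[ there t∈ e ]
Ancestor-lift t∈ (e Plus.∷ a) = there t∈ e Plus.∷ Ancestor-lift t∈ a

mutual
  root-Ancestor : ∀ (v : Fin N) ts {w} → w ∈ verticesOfForest ts →
                  Ancestor (node v ts) v w
  root-Ancestor v ts w∈ = root-Ancestor-via v ts ts id w∈

  -- The recursion consumes `us`, while the edges must be those of the unchanged node with children
  -- `ts`.
  root-Ancestor-via : ∀ (v : Fin N) ts us {w} → (∀ {t} → t ∈ us → t ∈ ts) →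
                      w ∈ verticesOfForest us → Ancestor (node v ts) v w
  root-Ancestor-via v ts (node u us ∷ vs) inc w∈ with ∈-++⁻ (vertices (node u us)) w∈
  ... | inj₁ (here refl) = Plus.[ here (inc (here refl)) ]
  ... | inj₁ (there w∈u) =
    here (inc (here refl)) Plus.∷ Ancestor-lift (inc (here refl)) (root-Ancestor u us w∈u)
  ... | inj₂ w∈vs = root-Ancestor-via v ts vs (inc ∘ there) w∈vs

root⊎Ancestor : (t : Tree N) → ∀ {w} → w ∈ vertices t → w ≡ root t ⊎ Ancestor t (root t) w
root⊎Ancestor (node v ts) (here refl) = inj₁ refl
root⊎Ancestor (node v ts) (there w∈)  = inj₂ (root-Ancestor v ts w∈)

Distinct-tree : {ts : List (Tree N)} → Unique (verticesOfForest ts) →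
                ∀ {t} → t ∈ ts → DistinctVertices t
Distinct-tree {ts = t ∷ _} u (here refl) = proj₁ (Unique-++⁻ (vertices t) u)
Distinct-tree {ts = t ∷ _} u (there t∈)  =
  Distinct-tree (proj₁ (proj₂ (Unique-++⁻ (vertices t) u))) t∈

-- The main use of distinct names: a node determines the child below which it lies.
same-tree : {ts : List (Tree N)} → Unique (verticesOfForest ts) →
            ∀ {t t′ w} → t ∈ ts → t′ ∈ ts → w ∈ vertices t → w ∈ vertices t′ → t ≡ t′
same-tree u (here refl) (here refl) w∈ w∈′ = refl
same-tree {ts = t ∷ _} u (here refl) (there t′∈) w∈ w∈′ =
  contradiction (∈-forest⁺ t′∈ w∈′) (proj₂ (proj₂ (Unique-++⁻ (vertices t) u)) w∈)
same-tree {ts = t ∷ _} u (there t∈) (here refl) w∈ w∈′ =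
  contradiction (∈-forest⁺ t∈ w∈) (proj₂ (proj₂ (Unique-++⁻ (vertices t) u)) w∈′)
same-tree {ts = t ∷ _} u (there t∈) (there t′∈) w∈ w∈′ =
  same-tree (proj₁ (proj₂ (Unique-++⁻ (vertices t) u))) t∈ t′∈ w∈ w∈′

Unique-trees : {ts : List (Tree N)} → Unique (verticesOfForest ts) → Unique ts
Unique-trees {ts = []}     u = []
Unique-trees {ts = t ∷ ts} u =
  All.tabulate (λ {t′} t′∈ eq → proj₂ (proj₂ (Unique-++⁻ (vertices t) u))
    (root∈vertices t) (∈-forest⁺ t′∈ (subst (λ s → root t ∈ vertices s) eq (root∈vertices t))))
  ∷ Unique-trees (proj₁ (proj₂ (Unique-++⁻ (vertices t) u)))

no-Edge-to-root : {t : Tree N} → DistinctVertices t → ∀ {u} → ¬ Edge t u (root t)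
no-Edge-to-root {t = node v ts} (v∉ ∷ _) e = All.lookup v∉ (Edge-target e) refl

no-Ancestor-of-root : {t : Tree N} → DistinctVertices t → ∀ {u} → ¬ Ancestor t u (root t)
no-Ancestor-of-root {t = node v ts} (v∉ ∷ _) a = All.lookup v∉ (Ancestor-target a) refl

-- Unions of collections, and cuts

∈-⋃⁻ : (S : Collection N) → ∀ {v} → v ∈ˢ ⋃ S → ∃[ A ] A ∈ S × v ∈ˢ A
∈-⋃⁻ []      v∈ = contradiction v∈ ∉⊥
∈-⋃⁻ (A ∷ S) v∈ with x∈p∪q⁻ A (⋃ S) v∈
... | inj₁ v∈A = A , here refl , v∈A
... | inj₂ v∈S with ∈-⋃⁻ S v∈S
... | B , B∈ , v∈B = B , there B∈ , v∈B

∈-⋃⁺ : {S : Collection N} → ∀ {A v} → A ∈ S → v ∈ˢ A → v ∈ˢ ⋃ S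
∈-⋃⁺ (here refl) v∈ = x∈p∪q⁺ (inj₁ v∈)
∈-⋃⁺ (there A∈)  v∈ = x∈p∪q⁺ (inj₂ (∈-⋃⁺ A∈ v∈))

roots : List (Tree N) → Subset N
roots b = ⋃ (map (⁅_⁆ ∘ root) b)

∈-roots⁺ : {b : List (Tree N)} → ∀ {t} → t ∈ b → root t ∈ˢ roots b
∈-roots⁺ t∈ = ∈-⋃⁺ (∈-map⁺ (⁅_⁆ ∘ root) t∈) (x∈⁅x⁆ _)

∈-roots⁻ : (b : List (Tree N)) → ∀ {w} → w ∈ˢ roots b → ∃[ t ] t ∈ b × w ≡ root t
∈-roots⁻ b w∈ with ∈-⋃⁻ (map (⁅_⁆ ∘ root) b) w∈
... | A , A∈ , w∈A with ∈-map⁻ (⁅_⁆ ∘ root) A∈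
... | t , t∈ , refl = t , t∈ , x∈⁅y⁆⇒x≡y (root t) w∈A

-- Conditions (3) and (4) depend on the collection only through its union C.
record IsCut (t : Tree N) (C : Fin N → Set) : Set where
  field
    covering  : ∀ {v} → v ∈ vertices t →
                C v ⊎ (∃[ w ] C w × Ancestor t v w) ⊎ (∃[ w ] C w × Ancestor t w v)
    antichain : ∀ {v w} → C v → C w → ¬ Ancestor t v w

open IsCut

-- Both conditions inspect vertices of `t` only, so agreement there suffices. This lets the union of
-- a collection on a larger tree serve as a cut of a subtree.
IsCut-cong : {t : Tree N} → ∀ {C D} → (∀ {w} → w ∈ vertices t → C w → D w) →
             (∀ {w} → w ∈ vertices t → D w → C w) → IsCut t C → IsCut t D
IsCut-cong to from cut .covering v∈ with covering cut v∈
... | inj₁ c                   = inj₁ (to v∈ c)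
... | inj₂ (inj₁ (w , c , a)) = inj₂ (inj₁ (w , to (Ancestor-target′ a) c , a))
... | inj₂ (inj₂ (w , c , a)) = inj₂ (inj₂ (w , to (Ancestor-source a) c , a))
IsCut-cong to from cut .antichain c d a =
  antichain cut (from (Ancestor-source a) c) (from (Ancestor-target′ a) d) a

IsCut-root : {t : Tree N} → DistinctVertices t → IsCut t (_≡ root t)
IsCut-root {t = t} D .covering v∈ with root⊎Ancestor t v∈
... | inj₁ eq = inj₁ eq
... | inj₂ a  = inj₂ (inj₂ (root t , refl , a))
IsCut-root D .antichain refl refl a = no-Ancestor-of-root D a

IsSweepCover⇒IsCut : {t : Tree N} → ∀ {S} → IsSweepCover t S → IsCut t (_∈ˢ ⋃ S)
IsSweepCover⇒IsCut cov = record
  { covering = IsSweepCover.covering cov ; antichain = IsSweepCover.antichain cov }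

-- Passing between a tree and the subtrees at its children

module Forest {N : ℕ} {v : Fin N} {ts : List (Tree N)} (D : DistinctVertices (node v ts)) where

  U : Unique (verticesOfForest ts)
  U = AllPairs.tail D

  v∉forest : ¬ v ∈ verticesOfForest ts
  v∉forest v∈ = All.lookup (AllPairs.head D) v∈ refl

  v∉tree : ∀ {t} → t ∈ ts → ¬ v ∈ vertices t
  v∉tree t∈ v∈ = v∉forest (∈-forest⁺ t∈ v∈)

  root-injective : ∀ {t t′} → t ∈ ts → t′ ∈ ts → root t ≡ root t′ → t ≡ t′
  root-injective {t} {t′} t∈ t′∈ eq =
    same-tree U t∈ t′∈ (root∈vertices t) (subst (_∈ vertices t′) (sym eq) (root∈vertices t′))

  Edge⁻ : ∀ {u w} → Edge (node v ts) u w →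
          (u ≡ v × ∃[ t ] t ∈ ts × w ≡ root t) ⊎ (∃[ t ] t ∈ ts × Edge t u w)
  Edge⁻ (here t∈)    = inj₁ (refl , _ , t∈ , refl)
  Edge⁻ (there t∈ e) = inj₂ (_ , t∈ , e)

  Ancestor⁻ : ∀ {u w} → Ancestor (node v ts) u w →
              u ≡ v ⊎ (∃[ t ] t ∈ ts × Ancestor t u w)
  Ancestor⁻ Plus.[ here t∈ ]    = inj₁ refl
  Ancestor⁻ Plus.[ there t∈ e ] = inj₂ (_ , t∈ , Plus.[ e ])
  Ancestor⁻ (here t∈ Plus.∷ a) = inj₁ refl
  Ancestor⁻ (there t∈ e Plus.∷ a) with Ancestor⁻ a
  -- An edge inside a child would end at `v`, which is not a vertex of that child.
  ... | inj₁ refl = contradiction (Edge-target′ e) (v∉tree t∈)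
  ... | inj₂ (t′ , t′∈ , a′)
    with refl ← same-tree U t∈ t′∈ (Edge-target′ e) (Ancestor-source a′) =
    inj₂ (t′ , t′∈ , e Plus.∷ a′)

  -- The node `v` is outside the cut, so it can only be covered as an ancestor of a member; the
  -- child `t₀` supplies one, because the cut of `t₀` contains its root or a descendant of it.
  IsCut-node⁺ : ∀ {C t₀} → t₀ ∈ ts → ¬ C v → (∀ {t} → t ∈ ts → IsCut t C) →
                IsCut (node v ts) C
  IsCut-node⁺ {t₀ = t₀} t₀∈ ¬Cv cut .covering (here refl)
    with covering (cut t₀∈) (root∈vertices t₀)
  ... | inj₁ c =
    inj₂ (inj₁ (root t₀ , c , root-Ancestor v ts (∈-forest⁺ t₀∈ (root∈vertices t₀))))
  ... | inj₂ (inj₁ (w , c , a)) =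
    inj₂ (inj₁ (w , c , root-Ancestor v ts (∈-forest⁺ t₀∈ (Ancestor-target′ a))))
  ... | inj₂ (inj₂ (w , c , a)) =
    contradiction a (no-Ancestor-of-root (Distinct-tree U t₀∈))
  IsCut-node⁺ t₀∈ ¬Cv cut .covering (there u∈) with ∈-forest⁻ ts u∈
  ... | t , t∈ , u∈t with covering (cut t∈) u∈t
  ... | inj₁ c                   = inj₁ c
  ... | inj₂ (inj₁ (w , c , a)) = inj₂ (inj₁ (w , c , Ancestor-lift t∈ a))
  ... | inj₂ (inj₂ (w , c , a)) = inj₂ (inj₂ (w , c , Ancestor-lift t∈ a))
  IsCut-node⁺ t₀∈ ¬Cv cut .antichain c d a with Ancestor⁻ a
  ... | inj₁ refl           = ¬Cv c
  ... | inj₂ (t , t∈ , a′) = antichain (cut t∈) c d a′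

  IsCut-node⁻ : ∀ {C} → ¬ C v → IsCut (node v ts) C → ∀ {t} → t ∈ ts → IsCut t C
  IsCut-node⁻ ¬Cv cut {t} t∈ .covering u∈ with covering cut (there (∈-forest⁺ t∈ u∈))
  ... | inj₁ c = inj₁ c
  ... | inj₂ (inj₁ (w , c , a)) with Ancestor⁻ a
  ...   | inj₁ refl = contradiction u∈ (v∉tree t∈)
  ...   | inj₂ (t′ , t′∈ , a′) with refl ← same-tree U t∈ t′∈ u∈ (Ancestor-source a′) =
    inj₂ (inj₁ (w , c , a′))
  IsCut-node⁻ ¬Cv cut {t} t∈ .covering u∈ | inj₂ (inj₂ (w , c , a)) with Ancestor⁻ a
  ...   | inj₁ refl = contradiction c ¬Cv
  ...   | inj₂ (t′ , t′∈ , a′) with refl ← same-tree U t∈ t′∈ u∈ (Ancestor-target′ a′) =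
    inj₂ (inj₂ (w , c , a′))
  IsCut-node⁻ ¬Cv cut t∈ .antichain c d a = antichain cut c d (Ancestor-lift t∈ a)

-- Counting and set equality of collections

AllPairs-map-∈ : {R Q : A → A → Set} {xs : List A} →
                 (∀ {x y} → x ∈ xs → y ∈ xs → R x y → Q x y) →
                 AllPairs R xs → AllPairs Q xs
AllPairs-map-∈ f []       = []
AllPairs-map-∈ f (p ∷ ps) =
  All.tabulate (λ y∈ → f (here refl) (there y∈) (All.lookup p y∈))
  ∷ AllPairs-map-∈ (λ x∈ y∈ → f (there x∈) (there y∈)) ps

_≟ˢ_ : DecidableEquality (Subset N)
_≟ˢ_ = ≡-dec Bool._≟_

distinct : Collection N → Collection N
distinct = deduplicate _≟ˢ_

-- Reduces counting to exhibiting a repetition-free list with the same members: two such lists are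
-- permutations of each other.
card-Unique : {S Z : Collection N} → Unique Z → S ∼[ set ] Z → card S ≡ length Z
card-Unique {S = S} u S∼Z = ↭-length (∼bag⇒↭ (unique∧set⇒bag (DecUnique.deduplicate-! _≟ˢ_ S) u
  (mk⇔ (Equivalence.to S∼Z ∘ Equivalence.from (deduplicate-∈⇔ _≟ˢ_))
       (Equivalence.to (deduplicate-∈⇔ _≟ˢ_) ∘ Equivalence.from S∼Z))))

∼-sym : {S S′ : Collection N} → S ∼[ set ] S′ → S′ ∼[ set ] S
∼-sym S∼S′ = mk⇔ (Equivalence.from S∼S′) (Equivalence.to S∼S′)

∼-trans : {S S′ S″ : Collection N} → S ∼[ set ] S′ → S′ ∼[ set ] S″ → S ∼[ set ] S″
∼-trans e f = mk⇔ (Equivalence.to f ∘ Equivalence.to e) (Equivalence.from e ∘ Equivalence.from f)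

card-cong : {S S′ : Collection N} → S ∼[ set ] S′ → card S ≡ card S′
card-cong {S′ = S′} S∼S′ = card-Unique (DecUnique.deduplicate-! _≟ˢ_ S′)
  (mk⇔ (Equivalence.to (deduplicate-∈⇔ _≟ˢ_) ∘ Equivalence.to S∼S′)
       (Equivalence.from S∼S′ ∘ Equivalence.from (deduplicate-∈⇔ _≟ˢ_)))

∈⇒1≤card : {S : Collection N} → ∀ {A} → A ∈ S → 1 ≤ card S
∈⇒1≤card A∈ = ∈-length (Equivalence.to (deduplicate-∈⇔ _≟ˢ_) A∈)

⋃-mono : {S S′ : Collection N} → (∀ {A} → A ∈ S → A ∈ S′) → ∀ {v} → v ∈ˢ ⋃ S → v ∈ˢ ⋃ S′
⋃-mono {S = S} inc v∈ with ∈-⋃⁻ S v∈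
... | A , A∈ , v∈A = ∈-⋃⁺ (inc A∈) v∈A

IsSweepCover-cong : {t : Tree N} → ∀ {S S′} → S ∼[ set ] S′ →
                    IsSweepCover t S → IsSweepCover t S′
IsSweepCover-cong {t = t} {S} {S′} S∼S′ cov = record
  { subset    = subset ∘ from
  ; nonempty  = nonempty ∘ from
  ; disjoint  = λ A∈ B∈ → disjoint (from A∈) (from B∈)
  ; siblings  = siblings ∘ from
  ; covering  = IsCut.covering cut
  ; antichain = IsCut.antichain cut
  }
  where
  open IsSweepCover cov hiding (covering; antichain)
  from : ∀ {A} → A ∈ S′ → A ∈ S
  from = Equivalence.from S∼S′
  cut : IsCut t (_∈ˢ ⋃ S′)
  cut = IsCut-cong (λ _ → ⋃-mono (Equivalence.to S∼S′)) (λ _ → ⋃-mono from)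
                   (IsSweepCover⇒IsCut cov)

SweepCoverOfSize-cong : {t : Tree N} → ∀ {n S S′} → S ∼[ set ] S′ →
                        SweepCoverOfSize t n S → SweepCoverOfSize t n S′
SweepCoverOfSize-cong S∼S′ (cov , c) =
  IsSweepCover-cong S∼S′ cov , trans (sym (card-cong S∼S′)) c

-- Covering the root already requires a member. Hence every cover has size at least 1, which is what
-- makes its size admissible as a part of a composition.
SweepCover-inhabited : {t : Tree N} → ∀ {S} → IsSweepCover t S → ∃[ A ] A ∈ S
SweepCover-inhabited {t = t} {S} cov with IsSweepCover.covering cov (root∈vertices t)
... | inj₁ v∈ = _ , proj₁ (proj₂ (∈-⋃⁻ S v∈))
... | inj₂ (inj₁ (w , w∈ , _)) = _ , proj₁ (proj₂ (∈-⋃⁻ S w∈))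
... | inj₂ (inj₂ (w , w∈ , _)) = _ , proj₁ (proj₂ (∈-⋃⁻ S w∈))

overlapping⇒≡ : {t : Tree N} → ∀ {S} → IsSweepCover t S → ∀ {A B x} → A ∈ S → B ∈ S →
                x ∈ˢ A → x ∈ˢ B → A ≡ B
overlapping⇒≡ cov {A} {B} A∈ B∈ x∈A x∈B with A ≟ˢ B
... | yes A≡B = A≡B
... | no  A≢B = contradiction (_ , x∈p∩q⁺ (x∈A , x∈B)) (IsSweepCover.disjoint cov A∈ B∈ A≢B)

rootCover : {t : Tree N} → DistinctVertices t → SweepCoverOfSize t 1 [ ⁅ root t ⁆ ]
rootCover {t = t} D = record
  { subset    = λ { (here refl) v∈ → subst (_∈ vertices t) (sym (x∈⁅y⁆⇒x≡y (root t) v∈))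
                                           (root∈vertices t) }
  ; nonempty  = λ { (here refl) → root t , x∈⁅x⁆ (root t) }
  ; disjoint  = λ { (here refl) (here refl) A≢A _ → A≢A refl }
  ; siblings  = λ { (here refl) → inj₂ refl }
  ; covering  = IsCut.covering cut
  ; antichain = IsCut.antichain cut
  } , refl
  where
  from : ∀ {w} → w ∈ˢ ⋃ [ ⁅ root t ⁆ ] → w ≡ root t
  from w∈ with ∈-⋃⁻ [ ⁅ root t ⁆ ] w∈
  ... | _ , here refl , w∈A = x∈⁅y⁆⇒x≡y (root t) w∈A
  cut : IsCut t (_∈ˢ ⋃ [ ⁅ root t ⁆ ])
  cut = IsCut-cong (λ { _ refl → ∈-⋃⁺ {S = [ ⁅ root t ⁆ ]} (here refl) (x∈⁅x⁆ (root t)) }) (λ _ → from)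
                   (IsCut-root D)

-- Assembling a sweep-cover from covers of some children and blocks of the others

CoveredChild : ℕ → Set
CoveredChild N = Tree N × Collection N

-- Follows the shape of the collections formed by `fromPartition`, so that in the intended reading
-- an output equals an assembled cover as a list, not only as a set.
assemble : List (CoveredChild N) → List (List (Tree N)) → Collection N
assemble P R = concat (map proj₂ P) ++ map roots R

module Assembly
  {N : ℕ} {v : Fin N} {ts : List (Tree N)} (D : DistinctVertices (node v ts))
  {P : List (CoveredChild N)} {R : List (List (Tree N))}
  (σ : map proj₁ P ++ concat R ↭ ts) (R≢[] : All (_≢ []) R)
  (covers : All (λ p → IsSweepCover (proj₁ p) (proj₂ p)) P)
  where

  open Forest {ts = ts} D
  S = assemble P R

  view : ∀ {A} → A ∈ S → (∃[ p ] p ∈ P × A ∈ proj₂ p) ⊎ (∃[ b ] b ∈ R × A ≡ roots b)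
  view A∈ with ∈-++⁻ (concat (map proj₂ P)) A∈
  ... | inj₂ A∈R = inj₂ (∈-map⁻ roots A∈R)
  ... | inj₁ A∈P with ∈-concat⁻′ (map proj₂ P) A∈P
  ... | Q , A∈Q , Q∈ with ∈-map⁻ proj₂ Q∈
  ... | p , p∈ , refl = inj₁ (p , p∈ , A∈Q)

  ∈P⇒∈S : ∀ {p A} → p ∈ P → A ∈ proj₂ p → A ∈ S
  ∈P⇒∈S p∈ A∈ = ∈-++⁺ˡ (∈-concat⁺′ A∈ (∈-map⁺ proj₂ p∈))

  ∈R⇒∈S : ∀ {b} → b ∈ R → roots b ∈ S
  ∈R⇒∈S b∈ = ∈-++⁺ʳ (concat (map proj₂ P)) (∈-map⁺ roots b∈)

  P⊆ts : ∀ {p} → p ∈ P → proj₁ p ∈ ts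
  P⊆ts p∈ = ∈-resp-↭ σ (∈-++⁺ˡ (∈-map⁺ proj₁ p∈))

  R⊆ts : ∀ {b t} → b ∈ R → t ∈ b → t ∈ ts
  R⊆ts b∈ t∈ = ∈-resp-↭ σ (∈-++⁺ʳ (map proj₁ P) (∈-concat⁺′ t∈ b∈))

  unique : Unique (map proj₁ P) × Unique (concat R) ×
           (∀ {t} → t ∈ map proj₁ P → ¬ t ∈ concat R)
  unique = Unique-++⁻ (map proj₁ P) (Unique-resp-↭ (↭-sym σ) (Unique-trees U))

  P-apart-R : ∀ {p b t} → p ∈ P → b ∈ R → t ∈ b → proj₁ p ≢ t
  P-apart-R p∈ b∈ t∈ refl = proj₂ (proj₂ unique) (∈-map⁺ proj₁ p∈) (∈-concat⁺′ t∈ b∈)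

  same-part : ∀ {p q w} → p ∈ P → q ∈ P → w ∈ vertices (proj₁ p) →
              w ∈ vertices (proj₁ q) → p ≡ q
  same-part p∈ q∈ w∈p w∈q = Unique-map-injective proj₁ (proj₁ unique) p∈ q∈
    (same-tree U (P⊆ts p∈) (P⊆ts q∈) w∈p w∈q)

  same-block : ∀ {b c w} → b ∈ R → c ∈ R → w ∈ˢ roots b → w ∈ˢ roots c → b ≡ c
  same-block {b} {c} b∈ c∈ w∈b w∈c with ∈-roots⁻ b w∈b | ∈-roots⁻ c w∈c
  ... | t , t∈ , refl | t′ , t′∈ , eq
    with refl ← root-injective (R⊆ts b∈ t∈) (R⊆ts c∈ t′∈) eq =
    Unique-concat-block R (proj₁ (proj₂ unique)) b∈ c∈ t∈ t′∈

  P-disjoint-R : ∀ {p b w} → p ∈ P → b ∈ R → w ∈ vertices (proj₁ p) → ¬ w ∈ˢ roots b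
  P-disjoint-R {b = b} p∈ b∈ w∈ w∈b with ∈-roots⁻ b w∈b
  ... | t , t∈ , refl = P-apart-R p∈ b∈ t∈
    (same-tree U (P⊆ts p∈) (R⊆ts b∈ t∈) w∈ (root∈vertices t))

  cover : ∀ {p} → p ∈ P → IsSweepCover (proj₁ p) (proj₂ p)
  cover = All.lookup covers

  inhabited : ∀ {b} → b ∈ R → ∃[ t ] t ∈ b
  inhabited {[]}    b∈ = contradiction refl (All.lookup R≢[] b∈)
  inhabited {t ∷ _} b∈ = t , here refl

  S⊆forest : ∀ {A w} → A ∈ S → w ∈ˢ A → w ∈ verticesOfForest ts
  S⊆forest A∈ w∈ with view A∈
  ... | inj₁ (p , p∈ , A∈p) = ∈-forest⁺ (P⊆ts p∈) (IsSweepCover.subset (cover p∈) A∈p w∈)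
  ... | inj₂ (b , b∈ , refl) with ∈-roots⁻ b w∈
  ... | t , t∈ , refl = ∈-forest⁺ (R⊆ts b∈ t∈) (root∈vertices t)

  S-overlapping⇒≡ : ∀ {A B w} → A ∈ S → B ∈ S → w ∈ˢ A → w ∈ˢ B → A ≡ B
  S-overlapping⇒≡ A∈ B∈ w∈A w∈B with view A∈ | view B∈
  ... | inj₁ (p , p∈ , A∈p) | inj₁ (q , q∈ , B∈q)
    with refl ← same-part p∈ q∈ (IsSweepCover.subset (cover p∈) A∈p w∈A)
                                (IsSweepCover.subset (cover q∈) B∈q w∈B) =
    overlapping⇒≡ (cover p∈) A∈p B∈q w∈A w∈B
  ... | inj₁ (p , p∈ , A∈p) | inj₂ (b , b∈ , refl) =
    contradiction w∈B (P-disjoint-R p∈ b∈ (IsSweepCover.subset (cover p∈) A∈p w∈A))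
  ... | inj₂ (b , b∈ , refl) | inj₁ (p , p∈ , B∈p) =
    contradiction w∈A (P-disjoint-R p∈ b∈ (IsSweepCover.subset (cover p∈) B∈p w∈B))
  ... | inj₂ (b , b∈ , refl) | inj₂ (c , c∈ , refl) = cong roots (same-block b∈ c∈ w∈A w∈B)

  -- Neither the other parts nor the blocks contain a vertex of this child, so within it the union
  -- of `S` is the union of its own cover.
  cut-part : ∀ {p} → p ∈ P → IsCut (proj₁ p) (_∈ˢ ⋃ S)
  cut-part {p} p∈ =
    IsCut-cong (λ _ → ⋃-mono (∈P⇒∈S p∈)) from (IsSweepCover⇒IsCut (cover p∈))
    where
    from : ∀ {w} → w ∈ vertices (proj₁ p) → w ∈ˢ ⋃ S → w ∈ˢ ⋃ (proj₂ p)
    from w∈ w∈S with ∈-⋃⁻ S w∈S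
    ... | A , A∈ , w∈A with view A∈
    ... | inj₂ (b , b∈ , refl) = contradiction w∈A (P-disjoint-R p∈ b∈ w∈)
    ... | inj₁ (q , q∈ , A∈q)
      with refl ← same-part p∈ q∈ w∈ (IsSweepCover.subset (cover q∈) A∈q w∈A) =
      ∈-⋃⁺ A∈q w∈A

  -- Inside a child belonging to a block, `S` contains the root and nothing else.
  cut-block : ∀ {b t} → b ∈ R → t ∈ b → IsCut t (_∈ˢ ⋃ S)
  cut-block {b} {t} b∈ t∈b = IsCut-cong to from (IsCut-root (Distinct-tree U t∈))
    where
    t∈ = R⊆ts b∈ t∈b
    to : ∀ {w} → w ∈ vertices t → w ≡ root t → w ∈ˢ ⋃ S
    to _ refl = ∈-⋃⁺ (∈R⇒∈S b∈) (∈-roots⁺ t∈b)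
    from : ∀ {w} → w ∈ vertices t → w ∈ˢ ⋃ S → w ≡ root t
    from w∈ w∈S with ∈-⋃⁻ S w∈S
    ... | A , A∈ , w∈A with view A∈
    ... | inj₁ (p , p∈ , A∈p) = contradiction
      (same-tree U (P⊆ts p∈) t∈ (IsSweepCover.subset (cover p∈) A∈p w∈A) w∈)
      (P-apart-R p∈ b∈ t∈b)
    ... | inj₂ (c , c∈ , refl) with ∈-roots⁻ c w∈A
    ... | t′ , t′∈ , refl = cong root (same-tree U (R⊆ts c∈ t′∈) t∈ (root∈vertices t′) w∈)

  child-part⊎block : ∀ {t} → t ∈ ts →
                     (∃[ p ] p ∈ P × t ≡ proj₁ p) ⊎ (∃[ b ] t ∈ b × b ∈ R)
  child-part⊎block t∈ with ∈-++⁻ (map proj₁ P) (∈-resp-↭ (↭-sym σ) t∈)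
  ... | inj₁ t∈P = inj₁ (∈-map⁻ proj₁ t∈P)
  ... | inj₂ t∈R = inj₂ (∈-concat⁻′ R t∈R)

  cut-child : ∀ {t} → t ∈ ts → IsCut t (_∈ˢ ⋃ S)
  cut-child t∈ = [ (λ { (p , p∈ , refl) → cut-part p∈ })
                 , (λ { (b , t∈b , b∈) → cut-block b∈ t∈b }) ]′ (child-part⊎block t∈)

  S-siblings : ∀ {A} → A ∈ S →
               (∃[ p ] ∀ {w} → w ∈ˢ A → Edge (node v ts) p w) ⊎ A ≡ ⁅ v ⁆
  S-siblings A∈ with view A∈
  S-siblings A∈ | inj₂ (b , b∈ , refl) = inj₁ (v , edge)
    where
    edge : ∀ {w} → w ∈ˢ roots b → Edge (node v ts) v w
    edge w∈ with ∈-roots⁻ b w∈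
    ... | t , t∈ , refl = here (R⊆ts b∈ t∈)
  S-siblings A∈ | inj₁ ((t , Q) , p∈ , A∈p) with IsSweepCover.siblings (cover p∈) A∈p
  ... | inj₁ (u , edge) = inj₁ (u , λ w∈ → there (P⊆ts p∈) (edge w∈))
  -- The exception for the singleton of the root is lost in the larger tree, but there this root has
  -- the parent `v`.
  ... | inj₂ refl       = inj₁ (v , λ w∈ →
    subst (Edge (node v ts) v) (sym (x∈⁅y⁆⇒x≡y (root t) w∈)) (here (P⊆ts p∈)))

  S-nonempty : ∀ {A} → A ∈ S → Nonempty A
  S-nonempty A∈ with view A∈
  ... | inj₁ (p , p∈ , A∈p)  = IsSweepCover.nonempty (cover p∈) A∈p
  ... | inj₂ (b , b∈ , refl) with inhabited b∈
  ... | t , t∈ = root t , ∈-roots⁺ t∈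

  isSweepCover : ∀ {t} → t ∈ ts → IsSweepCover (node v ts) S
  isSweepCover t∈ = record
    { subset    = λ A∈ w∈ → there (S⊆forest A∈ w∈)
    ; nonempty  = S-nonempty
    ; disjoint  = λ {A} {B} A∈ B∈ A≢B (x , x∈) →
        A≢B (S-overlapping⇒≡ A∈ B∈ (proj₁ (x∈p∩q⁻ A B x∈)) (proj₂ (x∈p∩q⁻ A B x∈)))
    ; siblings  = S-siblings
    ; covering  = IsCut.covering cut
    ; antichain = IsCut.antichain cut
    }
    where
    v∉S : ¬ v ∈ˢ ⋃ S
    v∉S v∈ with ∈-⋃⁻ S v∈
    ... | A , A∈ , v∈A = v∉forest (S⊆forest A∈ v∈A)
    cut : IsCut (node v ts) (_∈ˢ ⋃ S)
    cut = IsCut-node⁺ t∈ v∉S cut-child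

  -- Removing repetitions within each part is enough: a set shared by two parts, or by a part and a
  -- block, would be non-empty and so put one node into two children, and distinct blocks have
  -- distinct sets of roots.
  card-S : card S ≡ sum (map (card ∘ proj₂) P) + length R
  card-S = trans (card-Unique {S = S} uZ S∼Z)
    (trans (length-++ (concat (map (distinct ∘ proj₂) P)))
           (cong₂ _+_ (length-Z P) (length-map roots R)))
    where
    Z = concat (map (distinct ∘ proj₂) P) ++ map roots R

    length-Z : (P : List (CoveredChild N)) →
               length (concat (map (distinct ∘ proj₂) P)) ≡ sum (map (card ∘ proj₂) P)
    length-Z []      = refl
    length-Z (p ∷ P) = trans (length-++ (distinct (proj₂ p))) (cong (card (proj₂ p) +_) (length-Z P))

    undistinct : ∀ {A Q} → A ∈ distinct Q → A ∈ Q
    undistinct = Equivalence.from (deduplicate-∈⇔ _≟ˢ_)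

    Z⁻ : ∀ {A} → A ∈ concat (map (distinct ∘ proj₂) P) → ∃[ p ] p ∈ P × A ∈ proj₂ p
    Z⁻ A∈ with ∈-concat⁻′ (map (distinct ∘ proj₂) P) A∈
    ... | Q , A∈Q , Q∈ with ∈-map⁻ (distinct ∘ proj₂) Q∈
    ... | p , p∈ , refl = p , p∈ , undistinct A∈Q

    S∼Z : S ∼[ set ] Z
    S∼Z = mk⇔ to from
      where
      to : ∀ {A} → A ∈ S → A ∈ Z
      to A∈ with view A∈
      ... | inj₁ (p , p∈ , A∈p)  = ∈-++⁺ˡ (∈-concat⁺′
        (Equivalence.to (deduplicate-∈⇔ _≟ˢ_) A∈p) (∈-map⁺ (distinct ∘ proj₂) p∈))
      ... | inj₂ (b , b∈ , refl) =
        ∈-++⁺ʳ (concat (map (distinct ∘ proj₂) P)) (∈-map⁺ roots b∈)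
      from : ∀ {A} → A ∈ Z → A ∈ S
      from A∈ with ∈-++⁻ (concat (map (distinct ∘ proj₂) P)) A∈
      ... | inj₂ A∈R = ∈-++⁺ʳ (concat (map proj₂ P)) A∈R
      ... | inj₁ A∈P with Z⁻ A∈P
      ... | p , p∈ , A∈p = ∈P⇒∈S p∈ A∈p

    uZ : Unique Z
    uZ = Unique.++⁺
      (Unique.concat⁺ (All.map⁺ (All.tabulate λ {p} _ → DecUnique.deduplicate-! _≟ˢ_ (proj₂ p)))
        (AllPairs.map⁺ (AllPairs-map-∈ apart (AllPairs.map⁻ (proj₁ unique)))))
      (Unique-map roots inj (Unique-blocks R≢[] (proj₁ (proj₂ unique))))
      (λ (A∈P , A∈R) → separate A∈P A∈R)
      where
      apart : ∀ {p q} → p ∈ P → q ∈ P → proj₁ p ≢ proj₁ q →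
              ∀ {A} → ¬ (A ∈ distinct (proj₂ p) × A ∈ distinct (proj₂ q))
      apart p∈ q∈ p≢q (A∈p , A∈q) with IsSweepCover.nonempty (cover p∈) (undistinct A∈p)
      ... | x , x∈A = p≢q (same-tree U (P⊆ts p∈) (P⊆ts q∈)
        (IsSweepCover.subset (cover p∈) (undistinct A∈p) x∈A)
        (IsSweepCover.subset (cover q∈) (undistinct A∈q) x∈A))
      inj : ∀ {b c} → b ∈ R → c ∈ R → roots b ≡ roots c → b ≡ c
      inj b∈ c∈ eq with inhabited b∈
      ... | t , t∈ = same-block b∈ c∈ (∈-roots⁺ t∈) (subst (root t ∈ˢ_) eq (∈-roots⁺ t∈))
      separate : ∀ {A} → A ∈ concat (map (distinct ∘ proj₂) P) → ¬ A ∈ map roots R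
      separate A∈P A∈R with Z⁻ A∈P | ∈-map⁻ roots A∈R
      ... | p , p∈ , A∈p | b , b∈ , refl with inhabited b∈
      ... | t , t∈ = P-disjoint-R p∈ b∈
        (IsSweepCover.subset (cover p∈) A∈p (∈-roots⁺ t∈)) (∈-roots⁺ t∈)

-- Decomposing a sweep-cover that avoids the root

module Decomposition
  {N : ℕ} {v : Fin N} {ts : List (Tree N)} (D : DistinctVertices (node v ts))
  {S : Collection N} (cov : IsSweepCover (node v ts) S) (v∉S : ¬ v ∈ˢ ⋃ S)
  where

  open Forest {ts = ts} D

  cut-child : ∀ {t} → t ∈ ts → IsCut t (_∈ˢ ⋃ S)
  cut-child = IsCut-node⁻ v∉S (IsSweepCover⇒IsCut cov)

  view : ∀ {A} → A ∈ S → (∀ {w} → w ∈ˢ A → ∃[ t ] t ∈ ts × w ≡ root t)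
                       ⊎ (∃[ t ] t ∈ ts × ∃[ u ] ∀ {w} → w ∈ˢ A → Edge t u w)
  view {A} A∈ with IsSweepCover.siblings cov A∈
  ... | inj₂ refl = contradiction (∈-⋃⁺ A∈ (x∈⁅x⁆ v)) v∉S
  -- All elements share the parent `u`, so a single element decides whether `A` consists of roots of
  -- children or lies inside one child.
  ... | inj₁ (u , edge) with IsSweepCover.nonempty cov A∈
  ... | x , x∈ with Edge⁻ (edge x∈)
  ... | inj₁ (refl , _) = inj₁ λ w∈ → child (edge w∈)
    where
    child : ∀ {w} → Edge (node v ts) v w → ∃[ t ] t ∈ ts × w ≡ root t
    child e with Edge⁻ e
    ... | inj₁ (_ , t , t∈ , eq) = t , t∈ , eq
    ... | inj₂ (t , t∈ , e′)     = contradiction (Edge-source e′) (v∉tree t∈)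
  ... | inj₂ (t , t∈ , e) = inj₂ (t , t∈ , u , λ w∈ → inside (edge w∈))
    where
    inside : ∀ {w} → Edge (node v ts) u w → Edge t u w
    inside e′ with Edge⁻ e′
    ... | inj₁ (refl , _) = contradiction (Edge-source e) (v∉tree t∈)
    ... | inj₂ (t′ , t′∈ , e″)
      with refl ← same-tree U t∈ t′∈ (Edge-source e) (Edge-source e″) = e″

  -- Equality of keys is the equivalence whose classes are the blocks of H: the
  -- key of a child is the subcover containing it, or its singleton if none does.
  abstract
    keyed : ∀ t → Σ[ A ∈ Subset N ] root t ∈ˢ A ×
                  (A ∈ S ⊎ (A ≡ ⁅ root t ⁆ × (∀ {B} → B ∈ S → ¬ root t ∈ˢ B)))
    keyed t with any? (root t ∈?_) S
    ... | no  none = ⁅ root t ⁆ , x∈⁅x⁆ (root t) , inj₂ (refl , λ B∈ r∈ → none (lose B∈ r∈))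
    ... | yes some with find some
    ... | A , A∈ , r∈ = A , r∈ , inj₁ A∈

  key : Tree N → Subset N
  key t = proj₁ (keyed t)

  root∈key : ∀ t → root t ∈ˢ key t
  root∈key t = proj₁ (proj₂ (keyed t))

  key-member : ∀ t {A} → A ∈ S → root t ∈ˢ A → key t ≡ A
  key-member t A∈ r∈ with proj₂ (proj₂ (keyed t))
  ... | inj₁ k∈         = overlapping⇒≡ cov k∈ A∈ (root∈key t) r∈
  ... | inj₂ (_ , none) = contradiction r∈ (none A∈)

  -- A key outside `S` is the singleton of its own root, which no other child can share.
  key-shared : ∀ {t t′} → t ∈ ts → t′ ∈ ts → t ≢ t′ → key t ≡ key t′ → key t ∈ S
  key-shared {t} {t′} t∈ t′∈ t≢t′ eq with proj₂ (proj₂ (keyed t))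
  ... | inj₁ k∈        = k∈
  ... | inj₂ (k≡ , _) = contradiction (root-injective t∈ t′∈ (sym (x∈⁅y⁆⇒x≡y (root t)
    (subst (root t′ ∈ˢ_) (trans (sym eq) k≡) (root∈key t′))))) t≢t′

  abstract
    partition : ∃[ H ] H ∈ partitions ts × All (Uniform _≟ˢ_ key) H × AllPairs (Apart _≟ˢ_ key) H
    partition = partition-by-key _≟ˢ_ key ts

  H : List (List (Tree N))
  H = proj₁ partition

  H∈partitions : H ∈ partitions ts
  H∈partitions = proj₁ (proj₂ partition)

  block⊆ts : ∀ {b t} → b ∈ H → t ∈ b → t ∈ ts
  block⊆ts b∈ t∈ = ∈-resp-↭ (proj₁ (partitions-sound ts H∈partitions)) (∈-concat⁺′ t∈ b∈)

  block-of : ∀ {t} → t ∈ ts → ∃[ b ] t ∈ b × b ∈ H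
  block-of t∈ = ∈-concat⁻′ H
    (∈-resp-↭ (↭-sym (proj₁ (partitions-sound ts H∈partitions))) t∈)

  block-key : ∀ {b t t′} → b ∈ H → t ∈ b → t′ ∈ b → key t ≡ key t′
  block-key b∈ = All.lookup (proj₁ (proj₂ (proj₂ partition))) b∈

  key-block : ∀ {b t t′} → b ∈ H → t ∈ b → t′ ∈ ts → key t ≡ key t′ → t′ ∈ b
  key-block b∈ t∈ t′∈ eq with block-of t′∈
  ... | c , t′∈c , c∈ = subst (_ ∈_)
    (AllPairs-same (proj₂ (proj₂ (proj₂ partition))) c∈ b∈
      (λ apart → apart t′∈c t∈ (sym eq)) (λ apart → apart t∈ t′∈c eq)) t′∈c

  -- Meeting `t` is the condition, being decidable; when `t` is alone in its block, a member that
  -- meets `t` also lies inside it.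
  restrict : Tree N → Collection N
  restrict t = filter (λ A → any? (_∈? A) (vertices t)) S

  ∈-restrict⁺ : ∀ {t A w} → A ∈ S → w ∈ vertices t → w ∈ˢ A → A ∈ restrict t
  ∈-restrict⁺ {t} A∈ w∈t w∈A = ∈-filter⁺ (λ A → any? (_∈? A) (vertices t)) A∈ (lose w∈t w∈A)

  ∈-restrict⁻ : ∀ {t A} → A ∈ restrict t → A ∈ S × ∃[ w ] w ∈ vertices t × w ∈ˢ A
  ∈-restrict⁻ {t} A∈ with ∈-filter⁻ (λ A → any? (_∈? A) (vertices t)) {xs = S} A∈
  ... | A∈S , meets = A∈S , find meets

  module Singleton {t : Tree N} ([t]∈H : [ t ] ∈ H) where

    t∈ts : t ∈ ts
    t∈ts = block⊆ts [t]∈H (here refl)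

    -- Every child with its root in `A` has `A` as key, hence falls into the block of `t`, which
    -- contains only `t`.
    child-member : ∀ {A} → A ∈ S → root t ∈ˢ A →
                   (∀ {w} → w ∈ˢ A → ∃[ t′ ] t′ ∈ ts × w ≡ root t′) → A ≡ ⁅ root t ⁆
    child-member {A} A∈ r∈ child =
      ⊆-antisym into λ w∈ → subst (_∈ˢ A) (sym (x∈⁅y⁆⇒x≡y (root t) w∈)) r∈
      where
      into : ∀ {w} → w ∈ˢ A → w ∈ˢ ⁅ root t ⁆
      into w∈ with child w∈
      ... | t′ , t′∈ , refl
        with key-block [t]∈H (here refl) t′∈
               (trans (key-member t A∈ r∈) (sym (key-member t′ A∈ w∈)))
      ... | here refl = x∈⁅x⁆ (root t)

    ∈-restrict-view : ∀ {A} → A ∈ restrict t →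
                      A ≡ ⁅ root t ⁆ ⊎ (∃[ u ] ∀ {w} → w ∈ˢ A → Edge t u w)
    ∈-restrict-view {A} A∈ = view-at (∈-restrict⁻ {t} A∈)
      where
      view-at : A ∈ S × (∃[ x ] x ∈ vertices t × x ∈ˢ A) →
                A ≡ ⁅ root t ⁆ ⊎ (∃[ u ] ∀ {w} → w ∈ˢ A → Edge t u w)
      view-at (A∈S , x , x∈t , x∈A) = [ inj₁ ∘ roots-only , inj₂ ∘ inside ]′ (view A∈S)
        where
        roots-only : (∀ {w} → w ∈ˢ A → ∃[ t′ ] t′ ∈ ts × w ≡ root t′) → A ≡ ⁅ root t ⁆
        roots-only child = child-member A∈S (subst (_∈ˢ A) x≡root x∈A) child
          where
          t′∈ = proj₁ (proj₂ (child x∈A))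
          x≡ = proj₂ (proj₂ (child x∈A))
          x≡root : x ≡ root t
          x≡root = trans x≡ (cong root (same-tree U t′∈ t∈ts
            (subst (_∈ vertices (proj₁ (child x∈A))) (sym x≡) (root∈vertices _)) x∈t))
        inside : (∃[ t′ ] t′ ∈ ts × ∃[ u ] ∀ {w} → w ∈ˢ A → Edge t′ u w) →
                 ∃[ u ] ∀ {w} → w ∈ˢ A → Edge t u w
        inside (t′ , t′∈ , u , edge) = u , λ w∈ →
          subst (λ s → Edge s u _) (same-tree U t′∈ t∈ts (Edge-target′ (edge x∈A)) x∈t) (edge w∈)

    isSweepCover : IsSweepCover t (restrict t)
    isSweepCover = record
      { subset    = sub
      ; nonempty  = λ A∈ → IsSweepCover.nonempty cov (proj₁ (∈-restrict⁻ {t} A∈))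
      ; disjoint  = λ A∈ B∈ → IsSweepCover.disjoint cov (proj₁ (∈-restrict⁻ {t} A∈))
                                                        (proj₁ (∈-restrict⁻ {t} B∈))
      ; siblings  = λ A∈ → [ inj₂ , inj₁ ]′ (∈-restrict-view A∈)
      ; covering  = IsCut.covering cut
      ; antichain = IsCut.antichain cut
      }
      where
      sub : ∀ {A w} → A ∈ restrict t → w ∈ˢ A → w ∈ vertices t
      sub A∈ w∈ with ∈-restrict-view A∈
      ... | inj₁ refl       = subst (_∈ vertices t) (sym (x∈⁅y⁆⇒x≡y (root t) w∈)) (root∈vertices t)
      ... | inj₂ (u , edge) = Edge-target′ (edge w∈)
      to : ∀ {w} → w ∈ vertices t → w ∈ˢ ⋃ S → w ∈ˢ ⋃ (restrict t)
      to w∈t w∈S with ∈-⋃⁻ S w∈S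
      ... | A , A∈ , w∈A = ∈-⋃⁺ (∈-restrict⁺ A∈ w∈t w∈A) w∈A
      cut : IsCut t (_∈ˢ ⋃ (restrict t))
      cut = IsCut-cong to (λ _ → ⋃-mono (λ A∈ → proj₁ (∈-restrict⁻ {t} A∈))) (cut-child t∈ts)

  -- A member of `S` containing the root of a child cannot lie among the lower nodes of a child,
  -- since no edge inside a child ends at its root. So it consists of roots of children, and all
  -- these children have it as key.
  key≡roots : ∀ {b t} → b ∈ H → t ∈ b → key t ∈ S → key t ≡ roots b
  key≡roots {b} {t} b∈ t∈ k∈ = ⊆-antisym to from
    where
    from : ∀ {w} → w ∈ˢ roots b → w ∈ˢ key t
    from w∈ with ∈-roots⁻ b w∈
    ... | t′ , t′∈ , refl = subst (root t′ ∈ˢ_) (block-key b∈ t′∈ t∈) (root∈key t′)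
    to : ∀ {w} → w ∈ˢ key t → w ∈ˢ roots b
    to w∈ with view k∈
    ... | inj₂ (t′ , t′∈ , u , edge)
      with refl ← same-tree U (block⊆ts b∈ t∈) t′∈ (root∈vertices t)
                                (Edge-target′ (edge (root∈key t))) =
      contradiction (edge (root∈key t)) (no-Edge-to-root (Distinct-tree U t′∈))
    ... | inj₁ child with child w∈
    ... | t′ , t′∈ , refl = ∈-roots⁺ (key-block b∈ t∈ t′∈ (sym (key-member t′ k∈ w∈)))

  unique-H : Unique (concat H)
  unique-H = Unique-resp-↭ (↭-sym (proj₁ (partitions-sound ts H∈partitions))) (Unique-trees U)

  -- Such a block has two distinct children with a common key, which therefore is not the fallback
  -- singleton.
  nonSingleton-member : ∀ {b t} → b ∈ nonSingletons H → t ∈ b → key t ∈ S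
  nonSingleton-member b∈ t∈ = non-singleton (∈-nonSingletons⁻ H b∈) b∈ t∈
    where
    non-singleton : ∀ {b t} → b ∈ H → b ∈ nonSingletons H → t ∈ b → key t ∈ S
    non-singleton {_ ∷ []}        b∈H b∈ t∈ = contradiction b∈ (singleton∉nonSingletons H)
    non-singleton {t₁ ∷ t₂ ∷ b} b∈H b∈ t∈ =
      subst (_∈ S) (block-key b∈H (here refl) t∈)
        (key-shared (block⊆ts b∈H (here refl)) (block⊆ts b∈H (there (here refl)))
          (distinct-heads (block-unique b∈H))
          (block-key b∈H (here refl) (there (here refl))))
      where
      distinct-heads : ∀ {t₁ t₂ : Tree N} {b} → Unique (t₁ ∷ t₂ ∷ b) → t₁ ≢ t₂
      distinct-heads ((t₁≢t₂ ∷ _) ∷ _) = t₁≢t₂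
      block-unique : ∀ {b} → b ∈ H → Unique b
      block-unique = go H unique-H
        where
        go : ∀ H → Unique (concat H) → ∀ {b} → b ∈ H → Unique b
        go (c ∷ H) u (here refl) = proj₁ (Unique-++⁻ c u)
        go (c ∷ H) u (there b∈)  = go H (proj₁ (proj₂ (Unique-++⁻ c u))) b∈

  parts : List (CoveredChild N)
  parts = map (λ t → t , restrict t) (singletons H)

  covers : All (λ p → IsSweepCover (proj₁ p) (proj₂ p)) parts
  covers = All.map⁺ (All.tabulate λ t∈ → Singleton.isSweepCover (∈-singletons⁻ H t∈))

  parts-trees : map proj₁ parts ≡ singletons H
  parts-trees = trans (sym (map-∘ (singletons H))) (map-id (singletons H))

  singleton⊎nonSingleton : ∀ {t} → t ∈ ts →
    t ∈ singletons H ⊎ (∃[ b ] t ∈ b × b ∈ nonSingletons H)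
  singleton⊎nonSingleton t∈ with ∈-++⁻ (singletons H) (∈-resp-↭
    (↭-trans (↭-sym (proj₁ (partitions-sound ts H∈partitions))) (singletons-↭ H)) t∈)
  ... | inj₁ t∈L = inj₁ t∈L
  ... | inj₂ t∈R = inj₂ (∈-concat⁻′ (nonSingletons H) t∈R)

  S∼assemble : S ∼[ set ] assemble parts (nonSingletons H)
  S∼assemble = mk⇔ to from
    where
    R = nonSingletons H

    from-part : ∀ {t A} → t ∈ singletons H → A ∈ restrict t → A ∈ assemble parts R
    from-part {t} t∈ A∈ = ∈-++⁺ˡ (∈-concat⁺′ A∈ (∈-map⁺ proj₂ (∈-map⁺ (λ t → t , restrict t) t∈)))

    to : ∀ {A} → A ∈ S → A ∈ assemble parts R
    to A∈ with IsSweepCover.nonempty cov A∈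
    ... | x , x∈ with view A∈
    ... | inj₁ child with child x∈
    ... | t , t∈ , refl with singleton⊎nonSingleton t∈
    ... | inj₁ t∈L            = from-part t∈L (∈-restrict⁺ A∈ (root∈vertices t) x∈)
    ... | inj₂ (b , t∈b , b∈) = ∈-++⁺ʳ (concat (map proj₂ parts))
      (subst (_∈ map roots R)
        (trans (sym (key≡roots (∈-nonSingletons⁻ H b∈) t∈b (nonSingleton-member b∈ t∈b)))
               (key-member t A∈ x∈))
        (∈-map⁺ roots b∈))
    to A∈ | x , x∈ | inj₂ (t , t∈ , u , edge) with singleton⊎nonSingleton t∈
    ... | inj₁ t∈L            = from-part t∈L (∈-restrict⁺ A∈ (Edge-target′ (edge x∈)) x∈)
    -- The block puts the root of `t` into the cover, and `x` lies strictly below it, against the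
    -- antichain condition.
    ... | inj₂ (b , t∈b , b∈) with root⊎Ancestor t (Edge-target′ (edge x∈))
    ...   | inj₁ refl = contradiction (edge x∈) (no-Edge-to-root (Distinct-tree U t∈))
    ...   | inj₂ a    = contradiction a (IsCut.antichain (cut-child t∈)
      (∈-⋃⁺ (nonSingleton-member b∈ t∈b) (root∈key t)) (∈-⋃⁺ A∈ x∈))

    from : ∀ {A} → A ∈ assemble parts R → A ∈ S
    from A∈ with ∈-++⁻ (concat (map proj₂ parts)) A∈
    from A∈ | inj₁ A∈P with ∈-concat⁻′ (map proj₂ parts) A∈P
    ... | Q , A∈Q , Q∈ with ∈-map⁻ proj₂ Q∈
    ... | p , p∈ , refl with ∈-map⁻ (λ t → t , restrict t) p∈
    ... | t , t∈ , refl = proj₁ (∈-restrict⁻ {t} A∈Q)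
    from A∈ | inj₂ A∈R with ∈-map⁻ roots A∈R
    ... | b , b∈ , refl = block-member (∈-nonSingletons⁻ H b∈) b∈
      where
      block-member : ∀ {b} → b ∈ H → b ∈ R → roots b ∈ S
      block-member {[]}    b∈H b∈ =
        contradiction refl (All.lookup (proj₂ (partitions-sound ts H∈partitions)) b∈H)
      block-member {t ∷ b} b∈H b∈ = subst (_∈ S)
        (key≡roots b∈H (here refl) (nonSingleton-member b∈ (here refl)))
        (nonSingleton-member b∈ (here refl))

-- Hides the keys: completeness needs some partition with covers of its singletons, not the way in
-- which they were found.
record Decomposed {N : ℕ} (ts : List (Tree N)) (S : Collection N) : Set where
  field
    H           : List (List (Tree N))
    H∈          : H ∈ partitions ts
    P           : List (CoveredChild N)
    P-trees     : map proj₁ P ≡ singletons H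
    covers      : All (λ p → IsSweepCover (proj₁ p) (proj₂ p)) P
    S∼          : S ∼[ set ] assemble P (nonSingletons H)
    some        : ∃[ t ] t ∈ ts
    card≡       : card S ≡ sum (map (card ∘ proj₂) P) + length (nonSingletons H)

block-↭ : ∀ (ts : List (Tree N)) {H} {P : List (CoveredChild N)} → H ∈ partitions ts →
          map proj₁ P ≡ singletons H → map proj₁ P ++ concat (nonSingletons H) ↭ ts
block-↭ ts {H} H∈ eq =
  ↭-trans (↭-reflexive (cong (_++ concat (nonSingletons H)) eq))
    (↭-trans (↭-sym (singletons-↭ H)) (proj₁ (partitions-sound ts H∈)))

nonSingletons-nonempty : ∀ (xs : List A) {H} → H ∈ partitions xs → All (_≢ []) (nonSingletons H)
nonSingletons-nonempty xs {H} H∈ = All.tabulate λ b∈ →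
  All.lookup (proj₂ (partitions-sound xs H∈)) (∈-nonSingletons⁻ H b∈)

decompose : ∀ {v : Fin N} {ts S} → DistinctVertices (node v ts) →
            IsSweepCover (node v ts) S → ¬ v ∈ˢ ⋃ S → Decomposed ts S
decompose {N} {v} {ts} {S} D cov v∉S = record
  { H = H ; H∈ = H∈partitions ; P = parts ; P-trees = parts-trees
  ; covers = covers ; S∼ = S∼assemble ; some = some
  ; card≡ = trans (card-cong S∼assemble)
      (Assembly.card-S {ts = ts} D (block-↭ ts H∈partitions parts-trees)
        (nonSingletons-nonempty ts H∈partitions) covers) }
  where
  open Decomposition {N} {v} {ts} D {S} cov v∉S
  some : ∃[ t ] t ∈ ts
  some with SweepCover-inhabited cov
  ... | A , A∈ with IsSweepCover.nonempty cov A∈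
  ... | x , x∈ with view A∈
  ... | inj₂ (t , t∈ , _) = t , t∈
  ... | inj₁ child        = proj₁ (child x∈) , proj₁ (proj₂ (child x∈))

-- What the algorithm forms from one partition

child : Reading → List (Fin N) → Tree N → Child N
child ρ path t = root t , run ρ path t

runs≡map : ∀ ρ path (ts : List (Tree N)) → runs ρ path ts ≡ map (child ρ path) ts
runs≡map ρ path []       = refl
runs≡map ρ path (t ∷ ts) = cong (_ ∷_) (runs≡map ρ path ts)

nodeSet-child : ∀ ρ path (b : List (Tree N)) → nodeSet (map (child ρ path) b) ≡ roots b
nodeSet-child ρ path b = cong ⋃ (sym (map-∘ b))

nonSingletons-child : ∀ ρ path (H : List (List (Tree N))) →
  map nodeSet (nonSingletons (map (map (child ρ path)) H)) ≡ map roots (nonSingletons H)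
nonSingletons-child ρ path H =
  trans (cong (map nodeSet) (nonSingletons-map (child ρ path) H))
  (trans (sym (map-∘ (nonSingletons H)))
         (map-cong (nodeSet-child ρ path) (nonSingletons H)))

length-nonSingletons-map : (f : A → B) (H : List (List A)) →
                           length (nonSingletons (map (map f) H)) ≡ length (nonSingletons H)
length-nonSingletons-map f H =
  trans (cong length (nonSingletons-map f H)) (length-map (map f) (nonSingletons H))

if-∈⁻ : {P : Set} (d : Dec P) {xs ys : List A} {x : A} →
        x ∈ (if does d then xs else ys) → (P × x ∈ xs) ⊎ x ∈ ys
if-∈⁻ (yes p) x∈ = inj₁ (p , x∈)
if-∈⁻ (no _)  x∈ = inj₂ x∈

if-∈⁺ : {P : Set} (d : Dec P) {xs ys : List A} {x : A} →
        (P → x ∈ xs) → x ∈ ys → x ∈ (if does d then xs else ys)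
if-∈⁺ (yes p) x∈xs _    = x∈xs p
if-∈⁺ (no _)  _    x∈ys = x∈ys

[]∈choices : (L : List (Child N)) → [] ∈ choices (zipWith proj₂ L [])
[]∈choices []      = here refl
[]∈choices (_ ∷ _) = here refl

-- The shortcut for partitions without singletons is the case of the empty composition, so both
-- branches get one description. The bound on `length H` ensures that subtracting the number of
-- non-singletons from `n` is not truncated.
fromPartition⁻ : ∀ n (H : List (List (Child N))) {S} → length H ≤ n → S ∈ fromPartition n H →
  ∃[ X ] ∃[ Ss ] length X ≡ length (singletons H)
  × Ss ∈ choices (zipWith proj₂ (singletons H) X)
  × sum X + length (nonSingletons H) ≡ n
  × S ≡ concat Ss ++ map nodeSet (nonSingletons H)
fromPartition⁻ n H {S} |H|≤n S∈
  with if-∈⁻ ((length (singletons H) ≟ 0) ×-dec (length (map nodeSet (nonSingletons H)) ≟ n)) S∈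
... | inj₁ ((|L|≡0 , |R|≡n) , here refl) =
  [] , [] , sym |L|≡0 , []∈choices (singletons H) ,
  trans (sym (length-map nodeSet (nonSingletons H))) |R|≡n , refl
... | inj₂ S∈′ with find (∈-concatMap⁻ (λ X → filter (λ S → card S ≟ n)
                  (map (λ Ss → concat Ss ++ map nodeSet (nonSingletons H))
                       (choices (zipWith proj₂ (singletons H) X))))
                {xs = Γ (n ∸ length (map nodeSet (nonSingletons H))) (length (singletons H))} S∈′)
... | X , X∈ , S∈X with ∈-filter⁻ (λ S → card S ≟ n)
                          {xs = map (λ Ss → concat Ss ++ map nodeSet (nonSingletons H)) _} S∈X
... | S∈map , _ with ∈-map⁻ (λ Ss → concat Ss ++ map nodeSet (nonSingletons H)) S∈map
... | Ss , Ss∈ , refl with Γ-sound _ (length (singletons H)) X∈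
... | sumX , |X| =
  X , Ss , |X| , Ss∈ ,
  trans (cong₂ _+_ sumX (sym (length-map nodeSet (nonSingletons H)))) (m∸n+n≡m |R|≤n) , refl
  where
  |R|≤n : length (map nodeSet (nonSingletons H)) ≤ n
  |R|≤n = ≤-trans (≤-reflexive (length-map nodeSet (nonSingletons H)))
    (≤-trans (m≤n+m _ (length (singletons H)))
      (≤-trans (≤-reflexive (sym (length-singletons H))) |H|≤n))

fromPartition⁺ : ∀ n (H : List (List (Child N))) X Ss → All (1 ≤_) X →
  length X ≡ length (singletons H) → Ss ∈ choices (zipWith proj₂ (singletons H) X) →
  sum X + length (nonSingletons H) ≡ n →
  card (concat Ss ++ map nodeSet (nonSingletons H)) ≡ n →
  concat Ss ++ map nodeSet (nonSingletons H) ∈ fromPartition n H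
fromPartition⁺ n H X Ss pX |X| Ss∈ size card≡n =
  if-∈⁺ ((length (singletons H) ≟ 0) ×-dec (length (map nodeSet (nonSingletons H)) ≟ n))
    -- Without singletons the only choice is the empty one, so the collection is the one returned by
    -- the shortcut.
    (λ (|L|≡0 , _) → here (cong (λ Ss → concat Ss ++ map nodeSet (nonSingletons H))
                                (empty (singletons H) |L|≡0 Ss∈)))
    (∈-concatMap⁺ _ (lose X∈Γ (∈-filter⁺ (λ S → card S ≟ n) (∈-map⁺ _ Ss∈) card≡n)))
  where
  empty : ∀ L {X Ss} → length L ≡ 0 → Ss ∈ choices (zipWith proj₂ L X) → Ss ≡ []
  empty [] _ (here refl) = refl
  sumX : sum X ≡ n ∸ length (map nodeSet (nonSingletons H))
  sumX = trans (sym (m+n∸n≡m (sum X) (length (nonSingletons H))))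
    (cong₂ _∸_ size (sym (length-map nodeSet (nonSingletons H))))
  X∈Γ : X ∈ Γ (n ∸ length (map nodeSet (nonSingletons H))) (length (singletons H))
  X∈Γ = subst (λ x → X ∈ Γ x (length (singletons H))) sumX
    (subst (λ m → X ∈ Γ (sum X) m) |X| (Γ-complete pX))

-- Soundness up to replacement by a cover of the same size

-- What a run returns when it is not a node above t: in the literal reading
-- only the existence of a cover of the same size survives.
Realised : Reading → Tree N → ℕ → Collection N → Set
Realised ρ t n S = ∃[ S′ ] SweepCoverOfSize t n S′ × (ρ ≡ intended → S′ ≡ S)

-- Each recursive output is traded for a cover of equal size. The equation of lengths prevents
-- `zipWith` from dropping children.
choices-realised : ∀ ρ path (L : List (Tree N)) X {Ss} →
  All (λ t → ∀ m {S} → S ∈ run ρ path t m → Realised ρ t m S) L →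
  length X ≡ length (map (child ρ path) L) →
  Ss ∈ choices (zipWith proj₂ (map (child ρ path) L) X) →
  ∃[ P ] map proj₁ P ≡ L × All (λ p → IsSweepCover (proj₁ p) (proj₂ p)) P
  × sum (map (card ∘ proj₂) P) ≡ sum X × (ρ ≡ intended → map proj₂ P ≡ Ss)
choices-realised ρ path []      []      _ _ (here refl) = [] , refl , [] , refl , λ _ → refl
choices-realised ρ path (t ∷ L) (m ∷ X) (ih ∷ ihs) |X| Ss∈
  with ∈-cartesianProductWith⁻ _∷_ (run ρ path t m) _ Ss∈
... | S , Ss′ , S∈ , Ss′∈ , refl
  with ih m S∈ | choices-realised ρ path L X ihs (suc-injective |X|) Ss′∈
... | S′ , (cov , c) , eq | P , trees , covers , cards , eqs =
  (t , S′) ∷ P , cong (t ∷_) trees , cov ∷ covers , cong₂ _+_ c cards ,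
  λ i → cong₂ _∷_ (eq i) (eqs i)

-- The replacements are assembled with the blocks of the same partition. Additivity of `card` gives
-- the size: the sum of the composition plus the number of blocks is `n`.
partitions-realised : ∀ ρ path n {v : Fin N} {ts} → DistinctVertices (node v ts) →
  ∃[ t ] t ∈ ts →
  All (λ t → ∀ m {S} → S ∈ run ρ path t m → Realised ρ t m S) ts →
  ∀ {S} → S ∈ concatMap (fromPartition n) (admissiblePartitions n (runs ρ path ts)) →
  Realised ρ (node v ts) n S
partitions-realised ρ path n {v} {ts} D (t₀ , t₀∈) ih {S} S∈
  with find (∈-concatMap⁻ (fromPartition n) {xs = admissiblePartitions n (runs ρ path ts)} S∈)
... | H , H∈ , S∈H with ∈-filter⁻ (λ H → (1 ≤? length H) ×-dec (length H ≤? n ⊓ length (runs ρ path ts)))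
                                  {xs = partitions (runs ρ path ts)} H∈
... | H∈partitions , (_ , |H|≤)
  with ∈-map⁻ (map (map (child ρ path))) (subst (H ∈_)
         (trans (cong partitions (runs≡map ρ path ts)) (partitions-map (child ρ path) ts))
         H∈partitions)
... | H′ , H′∈ , refl
  with fromPartition⁻ n (map (map (child ρ path)) H′)
         (≤-trans |H|≤ (m⊓n≤m n (length (runs ρ path ts)))) S∈H
... | X , Ss , |X| , Ss∈ , size , S≡
  with choices-realised ρ path (singletons H′) X
         (All.tabulate λ t∈ → All.lookup ih
           (∈-resp-↭ (proj₁ (partitions-sound ts H′∈))
             (∈-resp-↭ (↭-sym (singletons-↭ H′)) (∈-++⁺ˡ t∈))))
         (trans |X| (cong length (singletons-map (child ρ path) H′)))
         (subst (λ L → Ss ∈ choices (zipWith proj₂ L X)) (singletons-map (child ρ path) H′) Ss∈)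
... | P , trees , covers , cards , eqs =
  assemble P (nonSingletons H′) ,
  (Assembly.isSweepCover {ts = ts} D (block-↭ ts H′∈ trees) (nonSingletons-nonempty ts H′∈) covers t₀∈ ,
   trans (Assembly.card-S {ts = ts} D (block-↭ ts H′∈ trees) (nonSingletons-nonempty ts H′∈) covers)
     (trans (cong₂ _+_ cards (sym (length-nonSingletons-map (child ρ path) H′))) size)) ,
  λ i → trans (cong₂ _++_ (cong concat (eqs i)) (sym (nonSingletons-child ρ path H′))) (sym S≡)

-- The outputs of `run` that name a node of the path: that node lies above `t` in the tree on which
-- the algorithm really acts, so these need not be covers of `t`.
OnPath : List (Fin N) → ℕ → Collection N → Set
OnPath path n S = n ≡ 1 × ∃[ w ] w ∈ path × S ≡ [ ⁅ w ⁆ ]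

onPath-∷ʳ : ∀ ρ {path : List (Fin N)} {t n S} → DistinctVertices t →
            OnPath (path ∷ʳ root t) n S → OnPath path n S ⊎ Realised ρ t n S
onPath-∷ʳ ρ {path} D (refl , w , w∈ , refl) with ∈-++⁻ path w∈
... | inj₁ w∈path      = inj₁ (refl , w , w∈path , refl)
... | inj₂ (here refl) = inj₂ (_ , rootCover D , λ _ → refl)

step-1⁻ : ∀ ρ (path : List (Fin N)) C {S} → S ∈ step ρ path C 1 →
          OnPath path 1 S ⊎ S ∈ allChildren ρ C
step-1⁻ ρ path C S∈ with ∈-++⁻ (map (λ w → [ ⁅ w ⁆ ]) path) S∈
... | inj₂ S∈all = inj₂ S∈all
... | inj₁ S∈map with ∈-map⁻ (λ w → [ ⁅ w ⁆ ]) S∈map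
... | w , w∈ , eq = inj₁ (refl , w , w∈ , eq)

allChildren-∷ : ∀ ρ (c : Child N) C → allChildren ρ (c ∷ C) ≡ [ [ nodeSet (c ∷ C) ] ]
allChildren-∷ literal  c C = refl
allChildren-∷ intended c C = refl

realised-all : ∀ ρ {v : Fin N} {t ts} → DistinctVertices (node v (t ∷ ts)) →
               Realised ρ (node v (t ∷ ts)) 1 [ roots (t ∷ ts) ]
realised-all ρ {t = t} {ts} D =
  [ roots (t ∷ ts) ] ,
  (Assembly.isSweepCover {ts = t ∷ ts} D {P = []} {R = [ t ∷ ts ]} σ ((λ ()) ∷ []) [] (here refl) ,
   Assembly.card-S {ts = t ∷ ts} D {P = []} {R = [ t ∷ ts ]} σ ((λ ()) ∷ []) []) , λ _ → refl
  where
  σ : concat [ t ∷ ts ] ↭ t ∷ ts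
  σ = ↭-reflexive (++-identityʳ (t ∷ ts))

realised-only-child : ∀ ρ {v : Fin N} {t n S} → DistinctVertices (node v [ t ]) →
                      Realised ρ t n S → Realised ρ (node v [ t ]) n S
realised-only-child ρ {t = t} D (S′ , (cov , c) , eq) =
  S′ , (subst (IsSweepCover _) S″≡S′
          (Assembly.isSweepCover {ts = [ t ]} D {P = [ t , S′ ]} {R = []} ↭-refl [] (cov ∷ []) (here refl)) , c) , eq
  where
  S″≡S′ : assemble [ t , S′ ] [] ≡ S′
  S″≡S′ = trans (++-identityʳ (S′ ++ [])) (++-identityʳ S′)

-- In the literal reading a recursive call may return an ancestor; it occurs at size 1 only, so the
-- singleton of the root of `t` can replace it. In the intended reading the path is empty.
realised-below : ∀ ρ {path : List (Fin N)} {t n S} → DistinctVertices t →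
                 OnPath (above ρ path) n S ⊎ Realised ρ t n S → Realised ρ t n S
realised-below ρ        D (inj₂ r)               = r
realised-below literal  D (inj₁ (refl , _))      = _ , rootCover D , λ ()
realised-below intended D (inj₁ (_ , _ , () , _))

mutual
  sound : ∀ ρ path (t : Tree N) → DistinctVertices t → ∀ n {S} → S ∈ run ρ path t n →
          OnPath path n S ⊎ Realised ρ t n S
  -- For other sizes a leaf has no output: the only partition of the empty list has no blocks, hence
  -- is not admissible.
  sound ρ path (node v []) D 1 S∈ with step-1⁻ ρ (path ∷ʳ v) [] S∈
  ... | inj₁ on = onPath-∷ʳ ρ D on
  -- The output here is the collection of the empty set; the root cover has the same size.
  sound literal path (node v []) D 1 S∈ | inj₂ _ = inj₂ (_ , rootCover D , λ ())
  sound ρ path (node v (t ∷ [])) D n S∈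
    with sound ρ (path ∷ʳ v) t (Distinct-tree {ts = [ t ]} (AllPairs.tail D) (here refl)) n S∈
  ... | inj₁ on = onPath-∷ʳ ρ D on
  ... | inj₂ r  = inj₂ (realised-only-child ρ D r)
  sound ρ path (node v (t ∷ t′ ∷ ts)) D 0 S∈ =
    inj₂ (partitions-realised ρ (above ρ (path ∷ʳ v)) 0 D (_ , here refl)
      (sounds ρ (path ∷ʳ v) (t ∷ t′ ∷ ts) (AllPairs.tail D)) S∈)
  sound ρ path (node v (t ∷ t′ ∷ ts)) D (suc (suc n)) S∈ =
    inj₂ (partitions-realised ρ (above ρ (path ∷ʳ v)) (suc (suc n)) D (_ , here refl)
      (sounds ρ (path ∷ʳ v) (t ∷ t′ ∷ ts) (AllPairs.tail D)) S∈)
  sound ρ path (node v (t ∷ t′ ∷ ts)) D 1 {S} S∈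
    with step-1⁻ ρ (path ∷ʳ v) (runs ρ (above ρ (path ∷ʳ v)) (t ∷ t′ ∷ ts)) S∈
  ... | inj₁ on = onPath-∷ʳ ρ D on
  ... | inj₂ S∈all with subst (S ∈_) (allChildren-∷ ρ _ _) S∈all
  ... | here eq = inj₂ (subst (Realised ρ _ 1) (sym (trans eq (cong [_] nodeSet≡)))
                              (realised-all ρ D))
    where
    nodeSet≡ : nodeSet (runs ρ (above ρ (path ∷ʳ v)) (t ∷ t′ ∷ ts)) ≡ roots (t ∷ t′ ∷ ts)
    nodeSet≡ = trans (cong nodeSet (runs≡map ρ (above ρ (path ∷ʳ v)) (t ∷ t′ ∷ ts)))
                     (nodeSet-child ρ (above ρ (path ∷ʳ v)) (t ∷ t′ ∷ ts))

  sounds : ∀ ρ path (ts : List (Tree N)) → Unique (verticesOfForest ts) →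
           All (λ t → ∀ n {S} → S ∈ run ρ (above ρ path) t n → Realised ρ t n S) ts
  sounds ρ path []       u = []
  sounds ρ path (t ∷ ts) u =
    (λ n S∈ → realised-below ρ D (sound ρ (above ρ path) t D n S∈))
    ∷ sounds ρ path ts (proj₁ (proj₂ (Unique-++⁻ (vertices t) u)))
    where D = Distinct-tree {ts = t ∷ ts} u (here refl)

-- Completeness

∈ᶜ-cong : {S S′ : Collection N} → ∀ {Q} → S ∼[ set ] S′ → S′ ∈ᶜ Q → S ∈ᶜ Q
∈ᶜ-cong S∼S′ = Any.map (∼-trans S∼S′)

path-node∈run : ∀ ρ path (t : Tree N) {w} → w ∈ path ∷ʳ root t → [ ⁅ w ⁆ ] ∈ run ρ path t 1
path-node∈run ρ path (node v [])            w∈ = ∈-++⁺ˡ (∈-map⁺ (λ w → [ ⁅ w ⁆ ]) w∈)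
path-node∈run ρ path (node v (t ∷ []))      w∈ = path-node∈run ρ (path ∷ʳ v) t (∈-++⁺ˡ w∈)
path-node∈run ρ path (node v (t ∷ t′ ∷ ts)) w∈ = ∈-++⁺ˡ (∈-map⁺ (λ w → [ ⁅ w ⁆ ]) w∈)

-- Every other vertex is a descendant of `v`, so the antichain condition leaves room for nothing
-- else.
rootCover-only : ∀ {v : Fin N} {ts S} → DistinctVertices (node v ts) →
                 IsSweepCover (node v ts) S → v ∈ˢ ⋃ S → S ∼[ set ] [ ⁅ v ⁆ ]
rootCover-only {v = v} {ts} {S} D cov v∈ = mk⇔ to from
  where
  ≡v : ∀ {w} → w ∈ˢ ⋃ S → w ∈ vertices (node v ts) → w ≡ v
  ≡v w∈ (here refl)  = refl
  ≡v w∈ (there w∈ts) =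
    contradiction (root-Ancestor v ts w∈ts) (IsSweepCover.antichain cov v∈ w∈)
  ≡⁅v⁆ : ∀ {A} → A ∈ S → A ≡ ⁅ v ⁆
  ≡⁅v⁆ {A} A∈ with IsSweepCover.nonempty cov A∈
  ... | x , x∈ = ⊆-antisym
    (λ w∈ → subst (_∈ˢ ⁅ v ⁆) (sym (in-A w∈)) (x∈⁅x⁆ v))
    (λ w∈ → subst (_∈ˢ A) (trans (in-A x∈) (sym (x∈⁅y⁆⇒x≡y v w∈))) x∈)
    where
    in-A : ∀ {w} → w ∈ˢ A → w ≡ v
    in-A w∈ = ≡v (∈-⋃⁺ A∈ w∈) (IsSweepCover.subset cov A∈ w∈)
  to : ∀ {A} → A ∈ S → A ∈ [ ⁅ v ⁆ ]
  to A∈ = here (≡⁅v⁆ A∈)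
  from : ∀ {A} → A ∈ [ ⁅ v ⁆ ] → A ∈ S
  from (here refl) with ∈-⋃⁻ S v∈
  ... | A , A∈ , _ = subst (_∈ S) (≡⁅v⁆ A∈) A∈

roots-cong : {b c : List (Tree N)} → b ↭ c → roots b ≡ roots c
roots-cong σ = ⊆-antisym (inc σ) (inc (↭-sym σ))
  where
  inc : ∀ {b c : List (Tree N)} → b ↭ c → ∀ {w} → w ∈ˢ roots b → w ∈ˢ roots c
  inc {b = b} σ w∈ with ∈-roots⁻ b w∈
  ... | t , t∈ , refl = ∈-roots⁺ (∈-resp-↭ σ t∈)

++-∼ : {S S′ R R′ : Collection N} → S ∼[ set ] S′ → R ∼[ set ] R′ → S ++ R ∼[ set ] S′ ++ R′
++-∼ {S = S} {S′} S∼S′ R∼R′ = mk⇔ (inc S∼S′ R∼R′) (inc (∼-sym S∼S′) (∼-sym R∼R′))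
  where
  inc : {S S′ R R′ : Collection N} → S ∼[ set ] S′ → R ∼[ set ] R′ →
        ∀ {A} → A ∈ S ++ R → A ∈ S′ ++ R′
  inc {S = S} {S′} e f A∈ with ∈-++⁻ S A∈
  ... | inj₁ A∈S = ∈-++⁺ˡ (Equivalence.to e A∈S)
  ... | inj₂ A∈R = ∈-++⁺ʳ S′ (Equivalence.to f A∈R)

∼-refl : {S : Collection N} → S ∼[ set ] S
∼-refl = mk⇔ id id

Recovered : Reading → List (Fin N) → CoveredChild N → Set
Recovered ρ path (t , Q) = Q ∈ᶜ run ρ path t (card Q)

choices-recover : ∀ ρ path (P : List (CoveredChild N)) → All (Recovered ρ path) P →
  ∃[ Ss ] Ss ∈ choices (zipWith proj₂ (map (child ρ path) (map proj₁ P)) (map (card ∘ proj₂) P))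
  × concat (map proj₂ P) ∼[ set ] concat Ss
choices-recover ρ path []            []         = [] , here refl , ∼-refl
choices-recover ρ path ((t , Q) ∷ P) (r ∷ rs) with find r | choices-recover ρ path P rs
... | Q′ , Q′∈ , Q∼Q′ | Ss , Ss∈ , Ss∼ =
  Q′ ∷ Ss , ∈-cartesianProductWith⁺ _∷_ Q′∈ Ss∈ , ++-∼ Q∼Q′ Ss∼

-- The composition is read off from the sizes of the parts. The partition is admissible: it has a
-- block as there is a child, at most `card S` blocks as each part contributes at least one
-- subcover, and at most as many blocks as children as no block is empty.
partitions-recover : ∀ ρ path {ts : List (Tree N)} {S} (d : Decomposed ts S) →
  All (Recovered ρ path) (Decomposed.P d) →
  S ∈ᶜ concatMap (fromPartition (card S)) (admissiblePartitions (card S) (runs ρ path ts))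
partitions-recover ρ path {ts} {S} d recovered with choices-recover ρ path (Decomposed.P d) recovered
... | Ss , Ss∈ , P∼Ss = lose (∈-concatMap⁺ (fromPartition n) (lose chH∈ S′∈)) S∼S′
  where
  open Decomposed d
  n = card S
  ch = child ρ path
  chH = map (map ch) H
  X = map (card ∘ proj₂) P
  S′ = concat Ss ++ map nodeSet (nonSingletons chH)

  S∼S′ : S ∼[ set ] S′
  S∼S′ = ∼-trans S∼ (++-∼ P∼Ss (subst (map roots (nonSingletons H) ∼[ set ]_)
    (sym (nonSingletons-child ρ path H)) ∼-refl))

  L≡ : map ch (map proj₁ P) ≡ singletons chH
  L≡ = trans (cong (map ch) P-trees) (sym (singletons-map ch H))

  |X| : length X ≡ length (singletons chH)
  |X| = trans (length-map _ P) (trans (sym (length-map proj₁ P))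
    (trans (sym (length-map ch (map proj₁ P))) (cong length L≡)))

  positive : All (λ p → 1 ≤ card (proj₂ p)) P
  positive = All.map (λ cov → ∈⇒1≤card (proj₂ (SweepCover-inhabited cov))) covers

  size : sum X + length (nonSingletons chH) ≡ n
  size = trans (cong (sum X +_) (length-nonSingletons-map ch H)) (sym card≡)

  S′∈ : S′ ∈ fromPartition n chH
  S′∈ = fromPartition⁺ n chH X Ss (All.map⁺ positive) |X|
    (subst (λ L → Ss ∈ choices (zipWith proj₂ L X)) L≡ Ss∈) size (sym (card-cong S∼S′))

  σ = proj₁ (partitions-sound ts H∈)

  1≤|H| : 1 ≤ length H
  1≤|H| = ∈-length (proj₂ (proj₂ (∈-concat⁻′ H (∈-resp-↭ (↭-sym σ) (proj₂ some)))))

  |H|≤n : length H ≤ n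
  |H|≤n = ≤-trans (≤-reflexive (length-singletons H)) (≤-trans
    (+-mono-≤ (≤-trans (≤-reflexive (trans (cong length (sym P-trees)) (length-map proj₁ P)))
                       (sum-map≥length (card ∘ proj₂) positive)) ≤-refl)
    (≤-reflexive (sym card≡)))

  |H|≤|ts| : length H ≤ length ts
  |H|≤|ts| = ≤-trans (length≤length-concat (proj₂ (partitions-sound ts H∈)))
                     (≤-reflexive (↭-length σ))

  |chH| = sym (length-map (map ch) H)

  chH∈ : chH ∈ admissiblePartitions n (runs ρ path ts)
  chH∈ = ∈-filter⁺ (λ H → (1 ≤? length H) ×-dec (length H ≤? n ⊓ length (runs ρ path ts)))
    (subst (chH ∈_)
      (sym (trans (cong partitions (runs≡map ρ path ts)) (partitions-map ch ts)))
      (∈-map⁺ (map (map ch)) H∈))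
    (subst (1 ≤_) |chH| 1≤|H| ,
     subst (_≤ n ⊓ length (runs ρ path ts)) |chH| (⊓-glb |H|≤n (subst (length H ≤_)
       (sym (trans (cong length (runs≡map ρ path ts)) (length-map ch ts))) |H|≤|ts|)))

-- With at least two children, a single subcover other than the root's
-- cannot lie below one child, so it comes from the one-block partition.
single-block : ∀ {t t′ : Tree N} {ts S} → Decomposed (t ∷ t′ ∷ ts) S → card S ≡ 1 →
               S ∼[ set ] [ roots (t ∷ t′ ∷ ts) ]
single-block {N} {t} {t′} {ts} {S} d card≡1 =
  by-parts P (nonSingletons H) (block-↭ (t ∷ t′ ∷ ts) H∈ P-trees) covers
    (trans (sym card≡) card≡1) S∼
  where
  open Decomposed d
  by-parts : ∀ P R → map proj₁ P ++ concat R ↭ t ∷ t′ ∷ ts →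
             All (λ p → IsSweepCover (proj₁ p) (proj₂ p)) P →
             sum (map (card ∘ proj₂) P) + length R ≡ 1 →
             S ∼[ set ] assemble P R → S ∼[ set ] [ roots (t ∷ t′ ∷ ts) ]
  by-parts [] (b ∷ []) σ _ _ S∼ = subst (λ A → S ∼[ set ] [ A ])
    (roots-cong (↭-trans (↭-reflexive (sym (++-identityʳ b))) σ)) S∼
  by-parts (p ∷ P) R σ (cov ∷ covers) size S∼ = contradiction (≤-trans two (≤-reflexive size)) λ { (s≤s ()) }
    where
    positive : All (λ p → 1 ≤ card (proj₂ p)) (p ∷ P)
    positive = All.map (λ cov → ∈⇒1≤card (proj₂ (SweepCover-inhabited cov))) (cov ∷ covers)
    two : 2 ≤ sum (map (card ∘ proj₂) (p ∷ P)) + length R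
    two = count P R (↭-length σ) positive
      where
      count : ∀ P R → length (map proj₁ (p ∷ P) ++ concat R) ≡ suc (suc (length ts)) →
             All (λ p → 1 ≤ card (proj₂ p)) (p ∷ P) →
             2 ≤ sum (map (card ∘ proj₂) (p ∷ P)) + length R
      -- A single part accounts for one of at least two children, so the length equation rules out
      -- an empty `R`.
      count []      (b ∷ R) _ (c ∷ [])     = +-mono-≤ (+-mono-≤ c z≤n) (s≤s z≤n)
      count (q ∷ P) R       _ (c ∷ c′ ∷ _) =
        ≤-trans (+-mono-≤ c (≤-trans c′ (m≤m+n _ _))) (m≤m+n _ (length R))

parts-recovered : ∀ {ρ path} {ts : List (Tree N)} {S} (d : Decomposed ts S) →
  All (λ t → ∀ {S} → IsSweepCover t S → S ∈ᶜ run ρ path t (card S)) ts →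
  All (Recovered ρ path) (Decomposed.P d)
parts-recovered {ts = ts} d complete = All.tabulate λ p∈ →
  All.lookup complete (∈-resp-↭ (block-↭ ts H∈ P-trees) (∈-++⁺ˡ (∈-map⁺ proj₁ p∈)))
    (All.lookup covers p∈)
  where open Decomposed d

mutual
  -- Using `card S` as the size makes the induction hypothesis apply to each part at exactly its
  -- entry of the composition.
  complete : ∀ ρ path (t : Tree N) → DistinctVertices t → ∀ {S} → IsSweepCover t S →
             S ∈ᶜ run ρ path t (card S)
  complete ρ path (node v ts) D {S} cov with v ∈? ⋃ S
  ... | yes v∈ = ∈ᶜ-cong S∼ (lose (subst (λ n → [ ⁅ v ⁆ ] ∈ run ρ path (node v ts) n)
      (sym (card-cong S∼)) (path-node∈run ρ path (node v ts) (∈-++⁺ʳ path (here refl)))) ∼-refl)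
    where
    S∼ = rootCover-only D cov v∈
  ... | no v∉ = complete-below ρ path v ts D (decompose D cov v∉)

  complete-below : ∀ ρ path (v : Fin N) ts → DistinctVertices (node v ts) → ∀ {S} →
                   Decomposed ts S → S ∈ᶜ run ρ path (node v ts) (card S)
  complete-below ρ path v [] D d = contradiction (proj₂ (Decomposed.some d)) λ ()
  -- The only partition of one child is `[ [ t ] ]`, so there is one part and no block, and `S` has
  -- the same members as the cover `Q` of `t`, to which the walk down the path moves on.
  complete-below ρ path v (t ∷ []) D {S} record
    { H∈ = here refl ; P = (_ , Q) ∷ [] ; P-trees = refl ; covers = cov ∷ [] ; S∼ = S∼ } =
    ∈ᶜ-cong S∼Q (subst (λ n → Q ∈ᶜ run ρ (path ∷ʳ v) t n) (sym (card-cong S∼Q))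
      (complete ρ (path ∷ʳ v) t (Distinct-tree {ts = [ t ]} (AllPairs.tail D) (here refl)) cov))
    where
    S∼Q : S ∼[ set ] Q
    S∼Q = subst (S ∼[ set ]_) (trans (++-identityʳ (Q ++ [])) (++-identityʳ Q)) S∼
  complete-below ρ path v (t ∷ t′ ∷ ts) D {S} d
    with card S in card≡n
       | partitions-recover ρ (above ρ (path ∷ʳ v)) d (parts-recovered d
           (completes ρ (above ρ (path ∷ʳ v)) (t ∷ t′ ∷ ts) (AllPairs.tail D)))
  -- Away from size 1, `step` is the search over partitions. At size 1 that search is not performed,
  -- and the one-block collection is found through `allChildren`.
  ... | 0           | r = r
  ... | suc (suc n) | r = r
  ... | 1           | _ = ∈ᶜ-cong
    (subst (λ A → S ∼[ set ] [ A ]) (sym nodeSet≡) (single-block d card≡n))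
    (lose (∈-++⁺ʳ (map (λ w → [ ⁅ w ⁆ ]) (path ∷ʳ v))
      (subst ([ nodeSet (runs ρ path′ (t ∷ t′ ∷ ts)) ] ∈_) (sym (allChildren-∷ ρ _ _)) (here refl))) ∼-refl)
    where
    path′ = above ρ (path ∷ʳ v)
    nodeSet≡ : nodeSet (runs ρ path′ (t ∷ t′ ∷ ts)) ≡ roots (t ∷ t′ ∷ ts)
    nodeSet≡ = trans (cong nodeSet (runs≡map ρ path′ (t ∷ t′ ∷ ts)))
                     (nodeSet-child ρ path′ (t ∷ t′ ∷ ts))

  completes : ∀ ρ path (ts : List (Tree N)) → Unique (verticesOfForest ts) →
              All (λ t → ∀ {S} → IsSweepCover t S → S ∈ᶜ run ρ path t (card S)) ts
  completes ρ path []       u = []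
  completes ρ path (t ∷ ts) u =
    complete ρ path t (Distinct-tree {ts = t ∷ ts} u (here refl))
    ∷ completes ρ path ts (proj₁ (proj₂ (Unique-++⁻ (vertices t) u)))

-- The algorithm on the whole tree

SweepCovers-realised : ∀ ρ (T : Tree N) → DistinctVertices T → ∀ n {S} →
                       S ∈ SweepCovers ρ T n → Realised ρ T n S
SweepCovers-realised ρ T D n S∈ with sound ρ [] T D n S∈
... | inj₂ r = r

SweepCovers-complete : ∀ ρ (T : Tree N) → DistinctVertices T → ∀ n S →
                       SweepCoverOfSize T n S → S ∈ᶜ SweepCovers ρ T n
SweepCovers-complete ρ T D n S (cov , refl) = complete ρ [] T D cov

-- Any output, even one that is no sweep-cover, guarantees a sweep-cover of size `n`; this is why
-- the claim survives in the literal reading.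
SweepCovers-empty : ∀ ρ (T : Tree N) → DistinctVertices T → ∀ n →
                    ¬ (∃[ S ] SweepCoverOfSize T n S) → SweepCovers ρ T n ≡ []
SweepCovers-empty ρ T D n none with SweepCovers ρ T n in eq
... | []    = refl
... | S ∷ Q with SweepCovers-realised ρ T D n (subst (S ∈_) (sym eq) (here refl))
... | S′ , cover , _ = contradiction (S′ , cover) none

SweepCovers-sound : ∀ (T : Tree N) → DistinctVertices T → ∀ n S →
                    S ∈ᶜ SweepCovers intended T n → SweepCoverOfSize T n S
SweepCovers-sound T D n S S∈ with find S∈
... | S′ , S′∈ , S∼S′ with SweepCovers-realised intended T D n S′∈
... | S″ , cover , S″≡S′ with refl ← S″≡S′ refl = SweepCoverOfSize-cong (∼-sym S∼S′) cover

theorem1 : ∀ {N : ℕ} (T : Tree N) → DistinctVertices T → (n : ℕ) →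
    ( (∀ S → (S ∈ᶜ SweepCovers intended T n) ⇔ SweepCoverOfSize T n S)
    × (¬ (∃[ S ] SweepCoverOfSize T n S) → SweepCovers intended T n ≡ []) )
    × ( (∀ S → SweepCoverOfSize T n S → S ∈ᶜ SweepCovers literal T n)
    × (¬ (∃[ S ] SweepCoverOfSize T n S) → SweepCovers literal T n ≡ []) )
theorem1 T D n =
  ( (λ S → mk⇔ (SweepCovers-sound T D n S) (SweepCovers-complete intended T D n S))
  , SweepCovers-empty intended T D n )
  , ( SweepCovers-complete literal T D n
    , SweepCovers-empty literal T D n )
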